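{- There exist a constant $c_0\in(0,1)$ and a 1-sided error, nonadaptive, $t$-online-erasure-resilient $\varepsilon$-tester for linearity of functions $f:\{0,1\}^d\to\{0,1\}$ that is correct whenever $t\le c_0\cdot \varepsilon^{5/4}\cdot 2^{d/4}$ and makes $O\big(\min\big(\frac{1}{\varepsilon}\log\frac{t}{\varepsilon},\ \frac{t}{\varepsilon}\big)\big)$ queries.
   Context: Online-erasure model. An input is a function $f:D\to R$ on a finite domain $D$. An algorithm accesses $f$ only through an oracle $\mathcal{O}$ by querying points $x\in D$ one at a time and receiving $\mathcal{O}(x)$. Initially $\mathcal{O}(x)=f(x)$ for all $x\in D$. For $t\in\mathbb{N}$, a $t$-online-erasure oracle, after answering each query, may choose up to $t$ points $x\in D$ and set $\mathcal{O}(x)=\perp$ (a special "erased" symbol); these values are used to answer all future queries. The choice of erasures (the adversarial strategy) may depend on $f$, on the queries and answers so far, and on the algorithm's code, but not on the algorithm's future random coins; the algorithm does not know where erasures are. A property $\mathcal{P}$ is a set of functions; $f$ is $\varepsilon$-far from $\mathcal{P}$ if for every $g\in\mathcal{P}$, $f$ and $g$ differ on at least an $\varepsilon$ fraction of $D$. A $t$-online-erasure-resilient $\varepsilon$-tester for $\mathcal{P}$ is a randomized algorithm that, given $t,\varepsilon$ and access to $f$ via a $t$-online-erasure oracle, for every adversarial strategy accepts with probability at least $2/3$ if $f\in\mathcal{P}$ and rejects with probability at least $2/3$ if $f$ is $\varepsilon$-far from $\mathcal{P}$. It has 1-sided error if it accepts every $f\in\mathcal{P}$ with probability 1; it is nonadaptive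 if its queries do not depend on answers to previous queries. A function $f:\{0,1\}^d\to\{0,1\}$ is linear if there is $S\subseteq[d]$ with $f(x)=\sum_{i\in S}x[i]\bmod 2$ for all $x=(x[1],\dots,x[d])$.
   Formalization: The proximity parameter ε ranges over the rational numbers in (0,1) instead of the reals; the query bound is stated for t ≥ 1, since log(t/ε) is undefined at t = 0. -}

module Defs where

open import Algebra.Definitions.RawSemiring using ()
open import Data.Bool.Base using (Bool; true; false; _∧_; _xor_)
import Data.Bool.Properties as Bool
open import Data.Integer.Base using (+_; ∣_∣)
open import Data.List.Base using (List; []; _∷_; _++_; length; filter; cartesianProductWith)
open import Data.List.Membership.Propositional using (_∈_)
import Data.List.Membership.DecPropositional as DecMembership
open import Data.List.Membership.Propositional.Properties using (∈-cartesianProductWith⁺)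
open import Data.List.Relation.Unary.All using ([]; _∷_)
open import Data.List.Relation.Unary.Any using (here; there)
open import Data.List.Relation.Unary.Unique.Propositional using (Unique; []; _∷_)
open import Data.List.Relation.Unary.Unique.Propositional.Properties using (cartesianProductWith⁺)
open import Data.Maybe.Base using (Maybe; just; nothing)
open import Data.Nat.Base as ℕ using (ℕ; zero; suc; NonZero)
open import Data.Fin.Subset using (Subset)
open import Data.Product.Base using (∃-syntax; _×_; _,_)
open import Data.Rational.Base
  using (ℚ; Positive; 1ℚ; _/_; _÷_; _*_; _≤_; ↥_; ↧ₙ_; +-*-rawSemiring)
open import Data.Rational.Properties using (pos⇒nonZero)
open import Data.Vec.Base as Vec using (Vec; []; _∷_)
open import Data.Vec.Bounded.Base using (Vec≤; toList)
open import Data.Vec.Properties using (≡-dec; ∷-injective)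
open import Level using (0ℓ)
open import Relation.Binary.Definitions using (DecidableEquality)
open import Relation.Binary.PropositionalEquality using (_≡_; refl)
open import Relation.Nullary using (¬?; yes; no)
open import Relation.Unary using (Pred; Decidable)

open Algebra.Definitions.RawSemiring +-*-rawSemiring public using (_^_)

fromℕ : ℕ → ℚ
fromℕ n = + n / 1

record FiniteSet : Set₁ where
  field
    Carrier  : Set
    _≟_      : DecidableEquality Carrier
    elements : List Carrier
    complete : ∀ x → x ∈ elements
    unique   : Unique elements
    nonEmpty : NonZero (length elements)

open FiniteSet using (Carrier)

-- Used both for probabilities under the uniform distribution on Ω and
-- for relative Hamming distance.
fraction : (Ω : FiniteSet) {P : Pred (Carrier Ω) 0ℓ} → Decidable P → ℚ
fraction Ω P? = (+ length (filter P? elements) / length elements) {{nonEmpty}}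
  where open FiniteSet Ω

cubePoints : ∀ d → List (Vec Bool d)
cubePoints zero    = [] ∷ []
cubePoints (suc d) = cartesianProductWith _∷_ (false ∷ true ∷ []) (cubePoints d)

private
  ∈-bools : ∀ b → b ∈ false ∷ true ∷ []
  ∈-bools false = here refl
  ∈-bools true  = there (here refl)

  cube-complete : ∀ {d} (x : Vec Bool d) → x ∈ cubePoints d
  cube-complete []      = here refl
  cube-complete (b ∷ x) = ∈-cartesianProductWith⁺ _∷_ (∈-bools b) (cube-complete x)

  cube-unique : ∀ d → Unique (cubePoints d)
  cube-unique zero    = [] ∷ []
  cube-unique (suc d) =
    cartesianProductWith⁺ _∷_ ∷-injective (((λ ()) ∷ []) ∷ [] ∷ []) (cube-unique d)

  ∈⇒nonEmpty : ∀ {A : Set} {x : A} {xs} → x ∈ xs → NonZero (length xs)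
  ∈⇒nonEmpty (here _)  = _
  ∈⇒nonEmpty (there _) = _

cube : ℕ → FiniteSet
cube d = record
  { Carrier  = Vec Bool d
  ; _≟_      = ≡-dec Bool._≟_
  ; elements = cubePoints d
  ; complete = cube-complete
  ; unique   = cube-unique d
  ; nonEmpty = ∈⇒nonEmpty (cube-complete (Vec.replicate d false))
  }

-- The answer `nothing` is the erasure symbol ⊥.  The output `true` means
-- accept and `false` means reject.
data DecisionTree (D R : Set) : Set where
  output : Bool → DecisionTree D R
  query  : D → (Maybe R → DecisionTree D R) → DecisionTree D R

-- All coins are tossed at the start, uniformly; they then select a
-- deterministic adaptive algorithm.
record Algorithm (D : FiniteSet) (R : Set) : Set₁ where
  field
    Coins : FiniteSet
    tree  : Carrier Coins → DecisionTree (Carrier D) R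

-- `Asks xs T`: whatever the answers, T queries exactly xs, in this order.
data Asks {D R : Set} : List D → DecisionTree D R → Set where
  output : ∀ {b} → Asks [] (output b)
  query  : ∀ {x xs k} → (∀ a → Asks xs (k a)) → Asks (x ∷ xs) (query x k)

data AsksAtMost {D R : Set} : ℕ → DecisionTree D R → Set where
  output : ∀ {q b} → AsksAtMost q (output b)
  query  : ∀ {q x k} → (∀ a → AsksAtMost q (k a)) → AsksAtMost (suc q) (query x k)

NonAdaptive : ∀ {D R} → Algorithm D R → Set
NonAdaptive A = ∀ ω → ∃[ xs ] Asks xs (tree ω)
  where open Algorithm A

MakesAtMost_queries : ∀ {D R} → ℕ → Algorithm D R → Set
MakesAtMost_queries q A = ∀ ω → AsksAtMost q (tree ω)
  where open Algorithm A

-- Queries with the answers received, most recent first.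
Transcript : Set → Set → Set
Transcript D R = List (D × Maybe R)

-- A strategy sees the transcript but not the coins.  Dependence on the input
-- and on the algorithm's code comes from quantifying over strategies after
-- both of these are fixed.
Strategy : ℕ → Set → Set → Set
Strategy t D R = Transcript D R → Vec≤ D t

module _ (D : FiniteSet) {R : Set} where
  open FiniteSet D using (_≟_)
  open DecMembership _≟_ using (_∈?_)

  oracle : (erased : List (Carrier D)) → (Carrier D → R) → Carrier D → Maybe R
  oracle erased f x with x ∈? erased
  ... | yes _ = nothing
  ... | no  _ = just (f x)

  runFrom : ∀ {t} → Transcript (Carrier D) R → (erased : List (Carrier D)) →
            Strategy t (Carrier D) R → (Carrier D → R) →
            DecisionTree (Carrier D) R → Bool
  runFrom h erased σ f (output b)  = b
  runFrom h erased σ f (query x k) = runFrom h′ (toList (σ h′) ++ erased) σ f (k a)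
    where
    a  = oracle erased f x
    h′ = (x , a) ∷ h

  run : ∀ {t} → Strategy t (Carrier D) R → (Carrier D → R) →
        DecisionTree (Carrier D) R → Bool
  run = runFrom [] []

Pr[_outputs_∣_,_] : ∀ {D R t} → Algorithm D R → Bool →
                    Strategy t (Carrier D) R → (Carrier D → R) → ℚ
Pr[_outputs_∣_,_] {D} A b σ f = fraction Coins (λ ω → run D σ f (tree ω) Bool.≟ b)
  where open Algorithm A

Property : FiniteSet → Set → Set₁
Property D R = Pred (Carrier D → R) 0ℓ

module _ {D : FiniteSet} {R : Set} (_≟ᴿ_ : DecidableEquality R) where

  dist : (f g : Carrier D → R) → ℚ
  dist f g = fraction D (λ x → ¬? (f x ≟ᴿ g x))

  Far : ℚ → Property D R → (Carrier D → R) → Set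
  Far ε 𝒫 f = ∀ g → 𝒫 g → ε ≤ dist f g

  record IsResilientTester (t : ℕ) (ε : ℚ) (𝒫 : Property D R) (A : Algorithm D R) : Set where
    field
      accepts : ∀ f (σ : Strategy t (Carrier D) R) → 𝒫 f →
                + 2 / 3 ≤ Pr[ A outputs true ∣ σ , f ]
      rejects : ∀ f (σ : Strategy t (Carrier D) R) → Far ε 𝒫 f →
                + 2 / 3 ≤ Pr[ A outputs false ∣ σ , f ]

OneSidedError : ∀ {D R} → ℕ → Property D R → Algorithm D R → Set
OneSidedError {D} {R} t 𝒫 A =
  ∀ f (σ : Strategy t (Carrier D) R) → 𝒫 f → Pr[ A outputs true ∣ σ , f ] ≡ 1ℚ

-- Σ_{i ∈ S} x[i] mod 2, where S is its characteristic vector.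
⊕[_] : ∀ {d} → Subset d → Vec Bool d → Bool
⊕[ S ] x = Vec.foldr′ _xor_ false (Vec.zipWith _∧_ S x)

Linear : ∀ d → Property (cube d) Bool
Linear d f = ∃[ S ] ∀ x → f x ≡ ⊕[ S ] x

-- t ≤ c₀ · ε^(5/4) · 2^(d/4), with both (nonnegative) sides raised to the
-- fourth power.
InRange : (c₀ : ℚ) (d t : ℕ) (ε : ℚ) → Set
InRange c₀ d t ε = fromℕ t ^ 4 ≤ c₀ ^ 4 * ε ^ 5 * fromℕ 2 ^ d

module _ (t : ℕ) (ε : ℚ) .{{_ : Positive ε}} where

  t÷ε : ℚ
  t÷ε = (fromℕ t ÷ ε) {{pos⇒nonZero ε}}

  -- q ≤ C · min ((1/ε) log₂ (t/ε) , t/ε), for t ≥ 1.  With ε = a/b in lowest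
  -- terms, the first bound reads a q ≤ b C log₂ (t/ε); it is stated
  -- with 2 raised to both sides.
  record QueryBound (C q : ℕ) : Set where
    field
      logarithmic : fromℕ 2 ^ (∣ ↥ ε ∣ ℕ.* q) ≤ t÷ε ^ (↧ₙ ε ℕ.* C)
      linear      : fromℕ q ≤ fromℕ C * t÷ε

{-# OPTIONS --safe #-}

-- The tester queries a random reserve z₁, …, zₙ, a random point x, and x + u_I and x + u_J for two
-- random subsets I, J, where u_I = Σ_{i ∈ I} zᵢ.  It rejects if no answer was erased and
-- f(x + u_I) ≠ f(x) + Σ_{i ∈ I} f(zᵢ), or the same for J.  With F = (−1)^f, averaging over x and I,
--   E F(x) F(x + u_I) Π_{i ∈ I} F(zᵢ) = Σ_S F̂(S)² [F and χ_S agree on all of z₁, …, zₙ],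
-- whose mean over z is at most (1 − ε)ⁿ if f is ε-far, because Σ_S F̂(S)² = 1.  Hence a reserve of size
-- n ≈ 17/ε already makes one of the two checks fail with probability close to 3/4, and no further checks
-- are needed.  Each query is uniform given the erasures made before x was asked, and after that
-- the adversary must guess u_I (or u_J), whose collision probability is at most 2⁻ⁿ + 2⁻ᵈ; adding 2 log t
-- to n makes this unlikely.

module Submission where

open import Defs
open import Algebra.Bundles using (CommutativeRing)
import Algebra.Properties.CommutativeSemiring.Exp as Exp
open import Data.Bool.Base using (Bool; true; false; not; _∧_; _∨_; _xor_; if_then_else_)
import Data.Bool.Properties as 𝔹
open import Data.Bool.Properties using (_≟_)
import Data.Integer.Base as ℤ
import Data.Integer.Properties as ℤ
open import Data.List.Base as List using (List; []; _∷_; length; filter; cartesianProductWith)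
open import Data.List.Membership.Propositional using (_∈_)
open import Data.List.Membership.Propositional.Properties using (∈-cartesianProductWith⁺)
open import Data.List.Relation.Unary.All using ([]; _∷_)
open import Data.List.Relation.Unary.Any using (here; there)
open import Data.List.Relation.Unary.Unique.Propositional using (Unique; []; _∷_)
open import Data.List.Relation.Unary.Unique.Propositional.Properties using (cartesianProductWith⁺)
open import Data.List.Properties using (length-++)
open import Data.Maybe.Base using (Maybe; just; nothing)
open import Data.Nat.Base as ℕ using (ℕ; zero; suc)
import Data.Nat.DivMod as ℕ
import Data.Nat.Properties as ℕ
import Data.Nat.Tactic.RingSolver as ℕ-Solver
open import Data.Product.Base using (Σ-syntax; ∃-syntax; _×_; _,_; proj₁; proj₂)
open import Data.Product.Properties using () renaming (≡-dec to ×-≡-dec)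
open import Data.Rational.Base hiding (∣_∣)
open import Data.Rational.Properties hiding (_≟_)
import Data.Rational.Properties as ℚ
import Data.Rational.Unnormalised.Base as ℚᵘ
import Data.Rational.Unnormalised.Properties as ℚᵘ
open import Data.Sum.Base using (_⊎_; inj₁; inj₂)
open import Data.Vec.Base as Vec using (Vec; []; _∷_; _++_)
open import Data.Vec.Properties
  using (∷-injective; ++-injective; length-toList; map-++; map-cong; take++drop≡id;
         zipWith-assoc; zipWith-comm; zipWith-identityˡ; zipWith-identityʳ)
  renaming (≡-dec to Vec-≡-dec)
open import Data.Vec.Bounded.Base as Vec≤ using (Vec≤)
open import Function.Base using (_∘_)
open import Level using (0ℓ)
open import Relation.Binary.PropositionalEquality
open import Relation.Nullary using (¬?; Dec; yes; no; does; contradiction)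
open import Relation.Nullary.Decidable using (True; toWitness; toWitnessFalse; _⊎-dec_)
open import Relation.Unary using (Pred; Decidable)
open import Tactic.RingSolver using (solve-∀)
open import Tactic.RingSolver.Core.AlmostCommutativeRing using (AlmostCommutativeRing; fromCommutativeRing)

open FiniteSet using (Carrier; elements)
open Exp (CommutativeRing.commutativeSemiring +-*-commutativeRing) using (^-homo-*; ^-assocʳ; ^-distrib-*)

-- Rational arithmetic and expectations over finite sets

-- A single check would not be enough: its passing probability is bounded by ½ (1 + (1 - ε)ⁿ), which
-- never falls below ½. Two checks sharing x bring the limit down to ¼, because the product of their
-- signs loses F(x)² = 1 and is again an autocorrelation of F, now at u_I + u_J. It therefore obeys
-- the same bound as each sign alone, and no independence of the two checks has to be proved. The
-- adversary is adaptive, so the actual run is compared with the run in which every answer is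
-- truthful: the two coincide until the first erased answer. In the truthful run the erasures made
-- at each moment are a function of the points asked so far, and only the position of the next
-- random point matters. The logarithmic query bound is an obstacle of its own. For t = 1 and ε near
-- 1 it tends to 0 and forbids even one query, so this regime needs a tester that asks nothing,
-- together with a proof that no function in the range is that far from linear.

ring : AlmostCommutativeRing 0ℓ 0ℓ
ring = fromCommutativeRing +-*-commutativeRing isZero
  where
  isZero : ∀ x → Maybe (0ℚ ≡ x)
  isZero x with 0ℚ ℚ.≟ x
  ... | yes 0≡x = just 0≡x
  ... | no  _   = nothing

-- `_/_` reduces by the gcd, so the identity is checked on unnormalised representatives, where it is
-- a cross multiplication. It is what turns a `fraction` into an expectation.
/≡*1/ : ∀ m n .{{_ : ℕ.NonZero n}} → ℤ.+ m / n ≡ fromℕ m * (ℤ.+ 1 / n)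
/≡*1/ m n@(suc k) = toℚᵘ-injective (begin
  toℚᵘ (ℤ.+ m / n)                             ≈⟨ toℚᵘ-fromℚᵘ (ℚᵘ.mkℚᵘ (ℤ.+ m) k) ⟩
  ℚᵘ.mkℚᵘ (ℤ.+ m) k                            ≈⟨ ℚᵘ.*≡* (cong₂ ℤ._*_
    (sym (ℤ.*-identityʳ (ℤ.+ m))) (cong (ℤ.+_ ∘ suc) (ℕ.+-identityʳ k))) ⟩
  ℚᵘ.mkℚᵘ (ℤ.+ m) 0 ℚᵘ.* ℚᵘ.mkℚᵘ (ℤ.+ 1) k       ≈⟨ ℚᵘ.*-cong
    (toℚᵘ-fromℚᵘ (ℚᵘ.mkℚᵘ (ℤ.+ m) 0)) (toℚᵘ-fromℚᵘ (ℚᵘ.mkℚᵘ (ℤ.+ 1) k)) ⟨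
  toℚᵘ (fromℕ m) ℚᵘ.* toℚᵘ (ℤ.+ 1 / n)         ≈⟨ toℚᵘ-homo-* (fromℕ m) (ℤ.+ 1 / n) ⟨
  toℚᵘ (fromℕ m * (ℤ.+ 1 / n))                 ∎)
  where open ℚᵘ.≃-Reasoning

fromℕ-+ : ∀ m n → fromℕ (m ℕ.+ n) ≡ fromℕ m + fromℕ n
fromℕ-+ m n = toℚᵘ-injective (begin
  toℚᵘ (fromℕ (m ℕ.+ n))                     ≈⟨ toℚᵘ-fromℚᵘ (ℚᵘ.mkℚᵘ (ℤ.+ (m ℕ.+ n)) 0) ⟩
  ℚᵘ.mkℚᵘ (ℤ.+ (m ℕ.+ n)) 0                    ≈⟨ ℚᵘ.*≡* (cong (ℤ._* ℤ.+ 1)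
    (trans (ℤ.pos-+ m n) (cong₂ ℤ._+_ (sym (ℤ.*-identityʳ (ℤ.+ m))) (sym (ℤ.*-identityʳ (ℤ.+ n)))))) ⟩
  ℚᵘ.mkℚᵘ (ℤ.+ m) 0 ℚᵘ.+ ℚᵘ.mkℚᵘ (ℤ.+ n) 0       ≈⟨ ℚᵘ.+-cong
    (toℚᵘ-fromℚᵘ (ℚᵘ.mkℚᵘ (ℤ.+ m) 0)) (toℚᵘ-fromℚᵘ (ℚᵘ.mkℚᵘ (ℤ.+ n) 0)) ⟨
  toℚᵘ (fromℕ m) ℚᵘ.+ toℚᵘ (fromℕ n)         ≈⟨ toℚᵘ-homo-+ (fromℕ m) (fromℕ n) ⟨
  toℚᵘ (fromℕ m + fromℕ n)                   ∎)
  where open ℚᵘ.≃-Reasoning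

fromℕ-suc : ∀ n → fromℕ (suc n) ≡ 1ℚ + fromℕ n
fromℕ-suc = fromℕ-+ 1

fromℕ-* : ∀ m n → fromℕ (m ℕ.* n) ≡ fromℕ m * fromℕ n
fromℕ-* zero    n = sym (*-zeroˡ (fromℕ n))
fromℕ-* (suc m) n = begin
  fromℕ (n ℕ.+ m ℕ.* n)          ≡⟨ fromℕ-+ n (m ℕ.* n) ⟩
  fromℕ n + fromℕ (m ℕ.* n)      ≡⟨ cong (fromℕ n +_) (fromℕ-* m n) ⟩
  fromℕ n + fromℕ m * fromℕ n    ≡⟨ lemma (fromℕ m) (fromℕ n) ⟩
  (1ℚ + fromℕ m) * fromℕ n       ≡⟨ cong (_* fromℕ n) (fromℕ-suc m) ⟨
  fromℕ (suc m) * fromℕ n        ∎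
  where
  open ≡-Reasoning
  lemma : ∀ a b → b + a * b ≡ (1ℚ + a) * b
  lemma = solve-∀ ring

fromℕ-mono : ∀ {m n} → m ℕ.≤ n → fromℕ m ≤ fromℕ n
fromℕ-mono {m} {n} m≤n = toℚᵘ-cancel-≤ (begin
  toℚᵘ (fromℕ m)   ≃⟨ toℚᵘ-fromℚᵘ (ℚᵘ.mkℚᵘ (ℤ.+ m) 0) ⟩
  ℚᵘ.mkℚᵘ (ℤ.+ m) 0  ≤⟨ ℚᵘ.*≤* (ℤ.*-monoʳ-≤-nonNeg (ℤ.+ 1) (ℤ.+≤+ m≤n)) ⟩
  ℚᵘ.mkℚᵘ (ℤ.+ n) 0  ≃⟨ toℚᵘ-fromℚᵘ (ℚᵘ.mkℚᵘ (ℤ.+ n) 0) ⟨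
  toℚᵘ (fromℕ n)   ∎)
  where open ℚᵘ.≤-Reasoning

0≤fromℕ : ∀ n → 0ℚ ≤ fromℕ n
0≤fromℕ n = fromℕ-mono {0} {n} ℕ.z≤n

1/-*-fromℕ : ∀ n .{{_ : ℕ.NonZero n}} → fromℕ n * (ℤ.+ 1 / n) ≡ 1ℚ
1/-*-fromℕ n@(suc k) = trans (sym (/≡*1/ n n)) (toℚᵘ-injective (begin
  toℚᵘ (ℤ.+ n / n)     ≈⟨ toℚᵘ-fromℚᵘ (ℚᵘ.mkℚᵘ (ℤ.+ n) k) ⟩
  ℚᵘ.mkℚᵘ (ℤ.+ n) k    ≈⟨ ℚᵘ.*≡* (ℤ.*-comm (ℤ.+ n) (ℤ.+ 1)) ⟩
  ℚᵘ.1ℚᵘ             ∎))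
  where open ℚᵘ.≃-Reasoning

0≤+/ : ∀ m n .{{_ : ℕ.NonZero n}} → 0ℚ ≤ ℤ.+ m / n
0≤+/ m n = nonNegative⁻¹ (ℤ.+ m / n) {{normalize-nonNeg m n}}

*-monoˡ : ∀ {p q r} → 0ℚ ≤ r → p ≤ q → r * p ≤ r * q
*-monoˡ {r = r} 0≤r = *-monoˡ-≤-nonNeg r {{nonNegative 0≤r}}

*-monoʳ : ∀ {p q r} → 0ℚ ≤ r → p ≤ q → p * r ≤ q * r
*-monoʳ {r = r} 0≤r = *-monoʳ-≤-nonNeg r {{nonNegative 0≤r}}

*-mono : ∀ {p q r s} → 0ℚ ≤ p → 0ℚ ≤ s → p ≤ q → r ≤ s → p * r ≤ q * s
*-mono 0≤p 0≤s p≤q r≤s = ≤-trans (*-monoˡ 0≤p r≤s) (*-monoʳ 0≤s p≤q)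

0≤* : ∀ {p q} → 0ℚ ≤ p → 0ℚ ≤ q → 0ℚ ≤ p * q
0≤* {p} {q} 0≤p 0≤q = subst (_≤ p * q) (*-zeroʳ p) (*-monoˡ 0≤p 0≤q)

0≤+ : ∀ {p q} → 0ℚ ≤ p → 0ℚ ≤ q → 0ℚ ≤ p + q
0≤+ = +-mono-≤ {0ℚ} {_} {0ℚ}

≤⇒0≤- : ∀ {p q} → p ≤ q → 0ℚ ≤ q - p
≤⇒0≤- {p} {q} p≤q = subst (_≤ q - p) (+-inverseʳ p) (+-monoˡ-≤ (- p) p≤q)

0≤-⇒≤ : ∀ {p q} → 0ℚ ≤ q - p → p ≤ q
0≤-⇒≤ {p} {q} h = subst₂ _≤_ (+-identityˡ p) (lemma q p) (+-monoˡ-≤ p h)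
  where
  lemma : ∀ a b → a - b + b ≡ a
  lemma = solve-∀ ring

0≤sq : ∀ p → 0ℚ ≤ p * p
0≤sq p with ≤-total 0ℚ p
... | inj₁ 0≤p = 0≤* 0≤p 0≤p
... | inj₂ p≤0 = subst (0ℚ ≤_) (lemma p) (0≤* 0≤-p 0≤-p)
  where
  0≤-p = neg-antimono-≤ p≤0
  lemma : ∀ a → - a * - a ≡ a * a
  lemma = solve-∀ ring

0≤^ : ∀ {p} n → 0ℚ ≤ p → 0ℚ ≤ p ^ n
0≤^ zero    _   = nonNegative⁻¹ 1ℚ
0≤^ (suc n) 0≤p = 0≤* 0≤p (0≤^ n 0≤p)

^-monoˡ : ∀ {p q} n → 0ℚ ≤ p → p ≤ q → p ^ n ≤ q ^ n
^-monoˡ zero    _   _   = ≤-refl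
^-monoˡ (suc n) 0≤p p≤q = *-mono 0≤p (0≤^ n (≤-trans 0≤p p≤q)) p≤q (^-monoˡ n 0≤p p≤q)

∑ : ∀ {A : Set} → List A → (A → ℚ) → ℚ
∑ []       g = 0ℚ
∑ (x ∷ xs) g = g x + ∑ xs g

module _ {A : Set} where

  ∑-cong : ∀ xs {g h : A → ℚ} → g ≗ h → ∑ xs g ≡ ∑ xs h
  ∑-cong []       eq = refl
  ∑-cong (x ∷ xs) eq = cong₂ _+_ (eq x) (∑-cong xs eq)

  ∑-mono : ∀ xs {g h : A → ℚ} → (∀ x → g x ≤ h x) → ∑ xs g ≤ ∑ xs h
  ∑-mono []       le = ≤-refl
  ∑-mono (x ∷ xs) le = +-mono-≤ (le x) (∑-mono xs le)

  ∑-+ : ∀ xs (g h : A → ℚ) → ∑ xs (λ x → g x + h x) ≡ ∑ xs g + ∑ xs h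
  ∑-+ []       g h = refl
  ∑-+ (x ∷ xs) g h rewrite ∑-+ xs g h = lemma (g x) (h x) (∑ xs g) (∑ xs h)
    where
    lemma : ∀ a b c d → a + b + (c + d) ≡ a + c + (b + d)
    lemma = solve-∀ ring

  ∑-*ˡ : ∀ xs c (g : A → ℚ) → ∑ xs (λ x → c * g x) ≡ c * ∑ xs g
  ∑-*ˡ []       c g = sym (*-zeroʳ c)
  ∑-*ˡ (x ∷ xs) c g rewrite ∑-*ˡ xs c g = sym (*-distribˡ-+ c (g x) (∑ xs g))

  ∑-*ʳ : ∀ xs c (g : A → ℚ) → ∑ xs (λ x → g x * c) ≡ ∑ xs g * c
  ∑-*ʳ xs c g = trans (∑-cong xs (λ x → *-comm (g x) c)) (trans (∑-*ˡ xs c g) (*-comm c (∑ xs g)))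

  ∑-const : ∀ (xs : List A) c → ∑ xs (λ _ → c) ≡ fromℕ (length xs) * c
  ∑-const []       c = sym (*-zeroˡ c)
  ∑-const (x ∷ xs) c = begin
    c + ∑ xs (λ _ → c)                ≡⟨ cong (λ ◌ → c + ◌) (∑-const xs c) ⟩
    c + fromℕ (length xs) * c         ≡⟨ lemma c (fromℕ (length xs)) ⟩
    (1ℚ + fromℕ (length xs)) * c      ≡⟨ cong (_* c) (fromℕ-suc (length xs)) ⟨
    fromℕ (suc (length xs)) * c       ∎
    where
    open ≡-Reasoning
    lemma : ∀ a b → a + b * a ≡ (1ℚ + b) * a
    lemma = solve-∀ ring

  ∑-++ : ∀ xs ys (g : A → ℚ) → ∑ (xs List.++ ys) g ≡ ∑ xs g + ∑ ys g
  ∑-++ []       ys g = sym (+-identityˡ (∑ ys g))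
  ∑-++ (x ∷ xs) ys g rewrite ∑-++ xs ys g = sym (+-assoc (g x) (∑ xs g) (∑ ys g))

∑-map : ∀ {A B : Set} (f : B → A) xs (g : A → ℚ) → ∑ (List.map f xs) g ≡ ∑ xs (g ∘ f)
∑-map f []       g = refl
∑-map f (x ∷ xs) g = cong (g (f x) +_) (∑-map f xs g)

∑-swap : ∀ {A B : Set} (xs : List A) (ys : List B) (g : A → B → ℚ) →
         ∑ xs (λ x → ∑ ys (g x)) ≡ ∑ ys (λ y → ∑ xs (λ x → g x y))
∑-swap []       ys g = sym (trans (∑-const ys 0ℚ) (*-zeroʳ (fromℕ (length ys))))
∑-swap (x ∷ xs) ys g rewrite ∑-swap xs ys g = sym (∑-+ ys (g x) _)

∑-cartesianProductWith : ∀ {A B C : Set} (f : A → B → C) xs ys (g : C → ℚ) →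
  ∑ (cartesianProductWith f xs ys) g ≡ ∑ xs (λ x → ∑ ys (λ y → g (f x y)))
∑-cartesianProductWith f []       ys g = refl
∑-cartesianProductWith f (x ∷ xs) ys g = trans
  (∑-++ (List.map (f x) ys) _ g)
  (cong₂ _+_ (∑-map (f x) ys g) (∑-cartesianProductWith f xs ys g))

indicator : ∀ {P : Set} → Dec P → ℚ
indicator P? = if does P? then 1ℚ else 0ℚ

0≤indicator : ∀ {P : Set} (P? : Dec P) → 0ℚ ≤ indicator P?
0≤indicator (yes _) = nonNegative⁻¹ 1ℚ
0≤indicator (no  _) = ≤-refl

length-filter-∑ : ∀ {A : Set} {P : Pred A 0ℓ} (P? : Decidable P) xs →
                  fromℕ (length (filter P? xs)) ≡ ∑ xs (indicator ∘ P?)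
length-filter-∑ P? []       = refl
length-filter-∑ P? (x ∷ xs) with P? x
... | yes _ = trans (fromℕ-suc (length (filter P? xs))) (cong (1ℚ +_) (length-filter-∑ P? xs))
... | no  _ = trans (length-filter-∑ P? xs) (sym (+-identityˡ _))

module _ (Ω : FiniteSet) where
  open FiniteSet Ω using (nonEmpty)

  1/∣_∣ : ℚ
  1/∣_∣ = (ℤ.+ 1 / length (elements Ω)) {{nonEmpty}}

  0≤1/∣∣ : 0ℚ ≤ 1/∣_∣
  0≤1/∣∣ = 0≤+/ 1 (length (elements Ω)) {{nonEmpty}}

𝔼 : (Ω : FiniteSet) → (Carrier Ω → ℚ) → ℚ
𝔼 Ω g = ∑ (elements Ω) g * 1/∣ Ω ∣

infix 5 𝔼
syntax 𝔼 Ω (λ x → e) = 𝔼[ x ∈ Ω ] e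

module _ (Ω : FiniteSet) where
  open FiniteSet Ω using (nonEmpty)

  private
    ι = 1/∣ Ω ∣

  𝔼-cong : ∀ {g h : Carrier Ω → ℚ} → g ≗ h → 𝔼 Ω g ≡ 𝔼 Ω h
  𝔼-cong eq = cong (_* ι) (∑-cong (elements Ω) eq)

  𝔼-mono : ∀ {g h : Carrier Ω → ℚ} → (∀ x → g x ≤ h x) → 𝔼 Ω g ≤ 𝔼 Ω h
  𝔼-mono le = *-monoʳ (0≤1/∣∣ Ω) (∑-mono (elements Ω) le)

  𝔼-+ : ∀ (g h : Carrier Ω → ℚ) → 𝔼 Ω (λ x → g x + h x) ≡ 𝔼 Ω g + 𝔼 Ω h
  𝔼-+ g h = trans (cong (_* ι) (∑-+ (elements Ω) g h)) (*-distribʳ-+ ι (∑ (elements Ω) g) (∑ (elements Ω) h))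

  𝔼-*ˡ : ∀ c (g : Carrier Ω → ℚ) → 𝔼 Ω (λ x → c * g x) ≡ c * 𝔼 Ω g
  𝔼-*ˡ c g = trans (cong (_* ι) (∑-*ˡ (elements Ω) c g)) (*-assoc c _ ι)

  𝔼-*ʳ : ∀ c (g : Carrier Ω → ℚ) → 𝔼 Ω (λ x → g x * c) ≡ 𝔼 Ω g * c
  𝔼-*ʳ c g = trans (𝔼-cong (λ x → *-comm (g x) c)) (trans (𝔼-*ˡ c g) (*-comm c (𝔼 Ω g)))

  𝔼-const : ∀ c → 𝔼 Ω (λ _ → c) ≡ c
  𝔼-const c = begin
    ∑ (elements Ω) (λ _ → c) * ι    ≡⟨ cong (_* ι) (∑-const (elements Ω) c) ⟩
    N * c * ι                       ≡⟨ lemma N c ι ⟩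
    N * ι * c                       ≡⟨ cong (_* c) (1/-*-fromℕ (length (elements Ω)) {{nonEmpty}}) ⟩
    1ℚ * c                          ≡⟨ *-identityˡ c ⟩
    c                               ∎
    where
    open ≡-Reasoning
    N = fromℕ (length (elements Ω))
    lemma : ∀ a b c → a * b * c ≡ a * c * b
    lemma = solve-∀ ring

  fraction≡𝔼 : ∀ {P : Pred (Carrier Ω) 0ℓ} (P? : Decidable P) →
               fraction Ω P? ≡ 𝔼 Ω (λ ω → indicator (P? ω))
  fraction≡𝔼 P? = trans
    (/≡*1/ (length (filter P? (elements Ω))) (length (elements Ω)) {{nonEmpty}})
    (cong (_* ι) (length-filter-∑ P? (elements Ω)))

𝔼-swap : ∀ A B (g : Carrier A → Carrier B → ℚ) →
         (𝔼[ a ∈ A ] 𝔼[ b ∈ B ] g a b) ≡ (𝔼[ b ∈ B ] 𝔼[ a ∈ A ] g a b)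
𝔼-swap A B g = begin
  ∑ as (λ a → ∑ bs (g a) * ιB) * ιA          ≡⟨ cong (_* ιA) (∑-*ʳ as ιB _) ⟩
  ∑ as (λ a → ∑ bs (g a)) * ιB * ιA          ≡⟨ cong (λ ◌ → ◌ * ιB * ιA) (∑-swap as bs g) ⟩
  ∑ bs (λ b → ∑ as (λ a → g a b)) * ιB * ιA  ≡⟨ lemma (∑ bs (λ b → ∑ as (λ a → g a b))) ιB ιA ⟩
  ∑ bs (λ b → ∑ as (λ a → g a b)) * ιA * ιB  ≡⟨ cong (_* ιB) (∑-*ʳ bs ιA _) ⟨
  ∑ bs (λ b → ∑ as (λ a → g a b) * ιA) * ιB  ∎
  where
  open ≡-Reasoning
  as = elements A
  bs = elements B
  ιA = 1/∣ A ∣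
  ιB = 1/∣ B ∣
  lemma : ∀ a b c → a * b * c ≡ a * c * b
  lemma = solve-∀ ring

-- Only the lists of elements enter: the list for C runs through that of B once for each element of
-- A. One statement thus serves `_⊗_`, `vectors` and `cube`.
𝔼-cartesianProductWith : ∀ {A B C} (f : Carrier A → Carrier B → Carrier C) →
  elements C ≡ cartesianProductWith f (elements A) (elements B) →
  ∀ g → 𝔼 C g ≡ (𝔼[ a ∈ A ] 𝔼[ b ∈ B ] g (f a b))
𝔼-cartesianProductWith {A} {B} {C} f eq g = begin
  ∑ (elements C) g * ιC                            ≡⟨ cong₂ _*_ (∑-C g) ιC≡ ⟩
  ∑ as (λ a → ∑ bs (λ b → g (f a b))) * (ιB * ιA)  ≡⟨ *-assoc (∑ as (λ a → ∑ bs (λ b → g (f a b)))) ιB ιA ⟨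
  ∑ as (λ a → ∑ bs (λ b → g (f a b))) * ιB * ιA    ≡⟨ cong (_* ιA) (∑-*ʳ as ιB _) ⟨
  (𝔼[ a ∈ A ] 𝔼[ b ∈ B ] g (f a b))                ∎
  where
  open ≡-Reasoning
  as = elements A
  bs = elements B
  ιA = 1/∣ A ∣
  ιB = 1/∣ B ∣
  ιC = 1/∣ C ∣
  nA = fromℕ (length as)
  nB = fromℕ (length bs)
  nC = fromℕ (length (elements C))
  ∑-C : ∀ h → ∑ (elements C) h ≡ ∑ as (λ a → ∑ bs (λ b → h (f a b)))
  ∑-C h = trans (cong (λ cs → ∑ cs h) eq) (∑-cartesianProductWith f as bs h)
  -- The cardinality is the sum identity at the constant 1; it then forces the value of `ιC`.
  nC≡ : nC ≡ nA * nB
  nC≡ = begin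
    nC                                  ≡⟨ *-identityʳ nC ⟨
    nC * 1ℚ                             ≡⟨ ∑-const (elements C) 1ℚ ⟨
    ∑ (elements C) (λ _ → 1ℚ)           ≡⟨ ∑-C (λ _ → 1ℚ) ⟩
    ∑ as (λ a → ∑ bs (λ b → 1ℚ))        ≡⟨ ∑-const as _ ⟩
    nA * ∑ bs (λ b → 1ℚ)                ≡⟨ cong (nA *_) (trans (∑-const bs 1ℚ) (*-identityʳ nB)) ⟩
    nA * nB                             ∎
  n*ι : ∀ Ω → fromℕ (length (elements Ω)) * 1/∣ Ω ∣ ≡ 1ℚ
  n*ι Ω = 1/-*-fromℕ (length (elements Ω)) {{FiniteSet.nonEmpty Ω}}
  lemma : ∀ a b c d e → a * (b * c) * (d * e) ≡ b * d * a * (e * c)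
  lemma = solve-∀ ring
  ιC≡ : ιC ≡ ιB * ιA
  ιC≡ = begin
    ιC                          ≡⟨ trans (*-identityʳ (ιC * 1ℚ)) (*-identityʳ ιC) ⟨
    ιC * 1ℚ * 1ℚ                ≡⟨ cong₂ (λ x y → ιC * x * y) (n*ι A) (n*ι B) ⟨
    ιC * (nA * ιA) * (nB * ιB)  ≡⟨ lemma ιC nA ιA nB ιB ⟩
    nA * nB * ιC * (ιB * ιA)    ≡⟨ cong (λ ◌ → ◌ * ιC * (ιB * ιA)) nC≡ ⟨
    nC * ιC * (ιB * ιA)         ≡⟨ cong (_* (ιB * ιA)) (n*ι C) ⟩
    1ℚ * (ιB * ιA)              ≡⟨ *-identityˡ (ιB * ιA) ⟩
    ιB * ιA                     ∎

bools : FiniteSet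
bools = record
  { Carrier = Bool ; _≟_ = _≟_ ; elements = false ∷ true ∷ []
  ; complete = λ { false → here refl ; true → there (here refl) }
  ; unique = ((λ ()) ∷ []) ∷ [] ∷ []
  ; nonEmpty = _ }

-- Fourier analysis on the cube

inhabitant : ∀ Ω → Carrier Ω
inhabitant Ω with elements Ω | FiniteSet.nonEmpty Ω
... | x ∷ _ | _ = x

∈⇒nonEmpty : ∀ {A : Set} {x : A} {xs} → x ∈ xs → ℕ.NonZero (length xs)
∈⇒nonEmpty (here _)  = _
∈⇒nonEmpty (there _) = _

infixr 2 _⊗_

_⊗_ : FiniteSet → FiniteSet → FiniteSet
A ⊗ B = record
  { Carrier  = A.Carrier × B.Carrier
  ; _≟_      = ×-≡-dec A._≟_ B._≟_
  ; elements = cartesianProductWith _,_ A.elements B.elements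
  ; complete = complete
  ; unique   = cartesianProductWith⁺ _,_ (λ { refl → refl , refl }) A.unique B.unique
  ; nonEmpty = ∈⇒nonEmpty (complete (inhabitant A , inhabitant B))
  }
  where
  module A = FiniteSet A
  module B = FiniteSet B
  complete : ∀ ab → ab ∈ cartesianProductWith _,_ A.elements B.elements
  complete (a , b) = ∈-cartesianProductWith⁺ _,_ (A.complete a) (B.complete b)

module _ (A : FiniteSet) where
  private module A = FiniteSet A

  allVectors : ∀ n → List (Vec A.Carrier n)
  allVectors zero    = [] ∷ []
  allVectors (suc n) = cartesianProductWith _∷_ A.elements (allVectors n)

  ∈-allVectors : ∀ {n} (v : Vec A.Carrier n) → v ∈ allVectors n
  ∈-allVectors []      = here refl
  ∈-allVectors (a ∷ v) = ∈-cartesianProductWith⁺ _∷_ (A.complete a) (∈-allVectors v)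

  allVectors-unique : ∀ n → Unique (allVectors n)
  allVectors-unique zero    = [] ∷ []
  allVectors-unique (suc n) = cartesianProductWith⁺ _∷_ ∷-injective A.unique (allVectors-unique n)

  vectors : ℕ → FiniteSet
  vectors n = record
    { Carrier  = Vec A.Carrier n
    ; _≟_      = Vec-≡-dec A._≟_
    ; elements = allVectors n
    ; complete = ∈-allVectors
    ; unique   = allVectors-unique n
    ; nonEmpty = ∈⇒nonEmpty (∈-allVectors (Vec.replicate n (inhabitant A)))
    }

𝔼-⊗ : ∀ A B g → 𝔼 (A ⊗ B) g ≡ (𝔼[ a ∈ A ] 𝔼[ b ∈ B ] g (a , b))
𝔼-⊗ A B = 𝔼-cartesianProductWith {A} {B} {A ⊗ B} _,_ refl

𝔼-[] : ∀ A g → 𝔼 (vectors A 0) g ≡ g []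
𝔼-[] A g = trans (*-identityʳ (g [] + 0ℚ)) (+-identityʳ (g []))

𝔼-∷ : ∀ A n g → 𝔼 (vectors A (suc n)) g ≡ (𝔼[ a ∈ A ] 𝔼[ v ∈ vectors A n ] g (a ∷ v))
𝔼-∷ A n = 𝔼-cartesianProductWith {A} {vectors A n} {vectors A (suc n)} _∷_ refl

𝔼-cube₀ : ∀ g → 𝔼 (cube 0) g ≡ g []
𝔼-cube₀ g = trans (*-identityʳ (g [] + 0ℚ)) (+-identityʳ (g []))

-- This split by the first coordinate drives the inductions for character sums, translations, point
-- masses and subset sums.
𝔼-cube₊ : ∀ d g → 𝔼 (cube (suc d)) g ≡
          ½ * ((𝔼[ x ∈ cube d ] g (false ∷ x)) + (𝔼[ x ∈ cube d ] g (true ∷ x)))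
𝔼-cube₊ d g = trans (𝔼-cartesianProductWith {bools} {cube d} {cube (suc d)} _∷_ refl g)
                    (lemma (𝔼[ x ∈ cube d ] g (false ∷ x)) (𝔼[ x ∈ cube d ] g (true ∷ x)))
  where
  lemma : ∀ a b → (a + (b + 0ℚ)) * ½ ≡ ½ * (a + b)
  lemma = solve-∀ ring

sgn : Bool → ℚ
sgn false = 1ℚ
sgn true  = - 1ℚ

sgn-xor : ∀ a b → sgn (a xor b) ≡ sgn a * sgn b
sgn-xor false false = refl
sgn-xor false true  = refl
sgn-xor true  false = refl
sgn-xor true  true  = refl

infixl 6 _⊕_

_⊕_ : ∀ {d} → Vec Bool d → Vec Bool d → Vec Bool d
_⊕_ = Vec.zipWith _xor_

⊕-assoc : ∀ {d} (x y z : Vec Bool d) → (x ⊕ y) ⊕ z ≡ x ⊕ (y ⊕ z)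
⊕-assoc = zipWith-assoc 𝔹.xor-assoc

χ : ∀ {d} → Vec Bool d → Vec Bool d → ℚ
χ S x = sgn (⊕[ S ] x)

χ-∷ : ∀ {d} b c (S x : Vec Bool d) → χ (b ∷ S) (c ∷ x) ≡ sgn (b ∧ c) * χ S x
χ-∷ b c S x = sgn-xor (b ∧ c) (⊕[ S ] x)

⊕[]-⊕ : ∀ {d} (S x y : Vec Bool d) → ⊕[ S ] (x ⊕ y) ≡ ⊕[ S ] x xor ⊕[ S ] y
⊕[]-⊕ []      []      []      = refl
⊕[]-⊕ (b ∷ S) (c ∷ x) (e ∷ y) rewrite ⊕[]-⊕ S x y = lemma b c e (⊕[ S ] x) (⊕[ S ] y)
  where
  lemma : ∀ b c e p q → (b ∧ (c xor e)) xor (p xor q) ≡ ((b ∧ c) xor p) xor ((b ∧ e) xor q)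
  lemma false c     e p q = refl
  lemma true  false false p q = refl
  lemma true  false true  false q = refl
  lemma true  false true  true  q = refl
  lemma true  true  false p q = 𝔹.not-distribˡ-xor p q
  lemma true  true  true  false q = sym (𝔹.not-involutive q)
  lemma true  true  true  true  q = refl

χ-⊕ : ∀ {d} (S x y : Vec Bool d) → χ S (x ⊕ y) ≡ χ S x * χ S y
χ-⊕ S x y = trans (cong sgn (⊕[]-⊕ S x y)) (sgn-xor (⊕[ S ] x) (⊕[ S ] y))

χ-comm : ∀ {d} (S x : Vec Bool d) → χ S x ≡ χ x S
χ-comm S x = cong (λ v → sgn (Vec.foldr′ _xor_ false v)) (zipWith-comm 𝔹.∧-comm S x)

-- The indicator of the zero vector, so `δ (a ⊕ b)` tests equality of a and b. Being
-- rational-valued, it can be averaged and expanded in characters.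
δ : ∀ {d} → Vec Bool d → ℚ
δ []          = 1ℚ
δ (false ∷ v) = δ v
δ (true  ∷ v) = 0ℚ

-- Orthogonality of characters: a coordinate in which v is `true` makes the two halves of the
-- average over S cancel.
𝔼-χ : ∀ {d} (v : Vec Bool d) → (𝔼[ S ∈ cube d ] χ S v) ≡ δ v
𝔼-χ []            = refl
𝔼-χ {suc d} (c ∷ v) = begin
  (𝔼[ S ∈ cube (suc d) ] χ S (c ∷ v))
    ≡⟨ 𝔼-cube₊ d (λ S → χ S (c ∷ v)) ⟩
  ½ * ((𝔼[ S ∈ cube d ] χ S v) + (𝔼[ S ∈ cube d ] χ (true ∷ S) (c ∷ v)))
    ≡⟨ cong (λ ◌ → ½ * ((𝔼[ S ∈ cube d ] χ S v) + ◌))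
         (trans (𝔼-cong (cube d) (λ S → χ-∷ true c S v)) (𝔼-*ˡ (cube d) (sgn c) (λ S → χ S v))) ⟩
  ½ * ((𝔼[ S ∈ cube d ] χ S v) + sgn c * (𝔼[ S ∈ cube d ] χ S v))
    ≡⟨ cong (λ ◌ → ½ * (◌ + sgn c * ◌)) (𝔼-χ v) ⟩
  ½ * (δ v + sgn c * δ v)
    ≡⟨ halves c ⟩
  δ (c ∷ v) ∎
  where
  open ≡-Reasoning
  agree : ∀ a → ½ * (a + 1ℚ * a) ≡ a
  agree = solve-∀ ring
  cancel : ∀ a → ½ * (a + - 1ℚ * a) ≡ 0ℚ
  cancel = solve-∀ ring
  halves : ∀ c → ½ * (δ v + sgn c * δ v) ≡ δ (c ∷ v)
  halves false = agree (δ v)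
  halves true  = cancel (δ v)

𝔼-shift : ∀ {d} (a : Vec Bool d) g → (𝔼[ x ∈ cube d ] g (x ⊕ a)) ≡ 𝔼 (cube d) g
𝔼-shift []              g = refl
𝔼-shift {suc d} (b ∷ a) g = begin
  (𝔼[ x ∈ cube (suc d) ] g (x ⊕ (b ∷ a)))
    ≡⟨ 𝔼-cube₊ d (λ x → g (x ⊕ (b ∷ a))) ⟩
  ½ * ((𝔼[ x ∈ cube d ] g (b ∷ x ⊕ a)) + (𝔼[ x ∈ cube d ] g (not b ∷ x ⊕ a)))
    ≡⟨ cong₂ (λ p q → ½ * (p + q)) (𝔼-shift a (g ∘ (b ∷_))) (𝔼-shift a (g ∘ (not b ∷_))) ⟩
  ½ * ((𝔼[ x ∈ cube d ] g (b ∷ x)) + (𝔼[ x ∈ cube d ] g (not b ∷ x)))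
    ≡⟨ flip-halves b ⟩
  ½ * ((𝔼[ x ∈ cube d ] g (false ∷ x)) + (𝔼[ x ∈ cube d ] g (true ∷ x)))
    ≡⟨ 𝔼-cube₊ d g ⟨
  𝔼 (cube (suc d)) g ∎
  where
  open ≡-Reasoning
  flip-halves : ∀ b → ½ * ((𝔼[ x ∈ cube d ] g (b ∷ x)) + (𝔼[ x ∈ cube d ] g (not b ∷ x))) ≡
                      ½ * ((𝔼[ x ∈ cube d ] g (false ∷ x)) + (𝔼[ x ∈ cube d ] g (true ∷ x)))
  flip-halves false = refl
  flip-halves true  = cong (λ ◌ → ½ * ◌)
    (+-comm (𝔼[ x ∈ cube d ] g (true ∷ x)) (𝔼[ x ∈ cube d ] g (false ∷ x)))

𝔼-δ* : ∀ {d} (a : Vec Bool d) (g : Vec Bool d → ℚ) → (𝔼[ x ∈ cube d ] δ (a ⊕ x) * g x) ≡ ½ ^ d * g a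
𝔼-δ* []              g = 𝔼-cube₀ (λ x → 1ℚ * g x)
𝔼-δ* {suc d} (b ∷ a) g = begin
  (𝔼[ x ∈ cube (suc d) ] δ ((b ∷ a) ⊕ x) * g x)
    ≡⟨ 𝔼-cube₊ d (λ x → δ ((b ∷ a) ⊕ x) * g x) ⟩
  ½ * (half b false + half b true)
    ≡⟨ cong (λ ◌ → ½ * ◌) (one-half b) ⟩
  ½ * (𝔼[ x ∈ cube d ] δ (a ⊕ x) * g (b ∷ x))
    ≡⟨ cong (λ ◌ → ½ * ◌) (𝔼-δ* a (g ∘ (b ∷_))) ⟩
  ½ * (½ ^ d * g (b ∷ a))
    ≡⟨ *-assoc ½ (½ ^ d) (g (b ∷ a)) ⟨
  ½ * ½ ^ d * g (b ∷ a) ∎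
  where
  open ≡-Reasoning
  half : Bool → Bool → ℚ
  half b c = 𝔼[ x ∈ cube d ] δ ((b xor c) ∷ a ⊕ x) * g (c ∷ x)
  vanish : ∀ c → (𝔼[ x ∈ cube d ] 0ℚ * g (c ∷ x)) ≡ 0ℚ
  vanish c = trans (𝔼-*ˡ (cube d) 0ℚ (λ x → g (c ∷ x))) (*-zeroˡ (𝔼[ x ∈ cube d ] g (c ∷ x)))
  one-half : ∀ b → half b false + half b true ≡ (𝔼[ x ∈ cube d ] δ (a ⊕ x) * g (b ∷ x))
  one-half false = trans (cong (λ ◌ → half false false + ◌) (vanish true)) (+-identityʳ (half false false))
  one-half true  = trans (cong (_+ half true true) (vanish false)) (+-identityˡ (half true true))

𝔼-δ : ∀ {d} (a : Vec Bool d) → (𝔼[ x ∈ cube d ] δ (a ⊕ x)) ≡ ½ ^ d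
𝔼-δ {d} a = trans (𝔼-cong (cube d) (λ x → sym (*-identityʳ (δ (a ⊕ x)))))
                  (trans (𝔼-δ* a (λ _ → 1ℚ)) (*-identityʳ (½ ^ d)))

module _ {d : ℕ} (F : Vec Bool d → ℚ) where

  autocorrelation : Vec Bool d → ℚ
  autocorrelation v = 𝔼[ x ∈ cube d ] F x * F (x ⊕ v)

  coefficient : Vec Bool d → ℚ
  coefficient S = 𝔼[ x ∈ cube d ] F x * χ S x

  -- Expanding both coefficients gives an average over x and y, in which orthogonality over S leaves
  -- only y = x ⊕ v. The factor ½ ^ d appears because S is averaged rather than summed.
  wiener-khinchin : ∀ v → (𝔼[ S ∈ cube d ] coefficient S * coefficient S * χ S v) ≡
                          ½ ^ d * autocorrelation v
  wiener-khinchin v = begin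
    (𝔼[ S ∈ cube d ] coefficient S * coefficient S * χ S v)
      ≡⟨ 𝔼-cong (cube d) expand ⟩
    (𝔼[ S ∈ cube d ] 𝔼[ x ∈ cube d ] 𝔼[ y ∈ cube d ] F x * (F y * χ S ((x ⊕ v) ⊕ y)))
      ≡⟨ 𝔼-swap (cube d) (cube d) (λ S x → 𝔼[ y ∈ cube d ] F x * (F y * χ S ((x ⊕ v) ⊕ y))) ⟩
    (𝔼[ x ∈ cube d ] 𝔼[ S ∈ cube d ] 𝔼[ y ∈ cube d ] F x * (F y * χ S ((x ⊕ v) ⊕ y)))
      ≡⟨ 𝔼-cong (cube d) contract ⟩
    (𝔼[ x ∈ cube d ] ½ ^ d * (F x * F (x ⊕ v)))
      ≡⟨ 𝔼-*ˡ (cube d) (½ ^ d) (λ x → F x * F (x ⊕ v)) ⟩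
    ½ ^ d * autocorrelation v ∎
    where
    open ≡-Reasoning
    rearrange : ∀ p q r s t → p * q * (r * s) * t ≡ p * (r * (q * t * s))
    rearrange = solve-∀ ring
    expand : ∀ S → coefficient S * coefficient S * χ S v ≡
                   (𝔼[ x ∈ cube d ] 𝔼[ y ∈ cube d ] F x * (F y * χ S ((x ⊕ v) ⊕ y)))
    expand S = begin
      coefficient S * coefficient S * χ S v
        ≡⟨ *-assoc (coefficient S) (coefficient S) (χ S v) ⟩
      coefficient S * (coefficient S * χ S v)
        ≡⟨ 𝔼-*ʳ (cube d) (coefficient S * χ S v) (λ x → F x * χ S x) ⟨
      (𝔼[ x ∈ cube d ] F x * χ S x * (coefficient S * χ S v))
        ≡⟨ 𝔼-cong (cube d) (λ x → trans (sym (*-assoc (F x * χ S x) (coefficient S) (χ S v)))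
             (trans (cong (_* χ S v) (sym (𝔼-*ˡ (cube d) (F x * χ S x) (λ y → F y * χ S y))))
             (sym (𝔼-*ʳ (cube d) (χ S v) (λ y → F x * χ S x * (F y * χ S y)))))) ⟩
      (𝔼[ x ∈ cube d ] 𝔼[ y ∈ cube d ] F x * χ S x * (F y * χ S y) * χ S v)
        ≡⟨ 𝔼-cong (cube d) (λ x → 𝔼-cong (cube d) (λ y → trans
             (rearrange (F x) (χ S x) (F y) (χ S y) (χ S v))
             (cong (λ ◌ → F x * (F y * ◌))
               (sym (trans (χ-⊕ S (x ⊕ v) y) (cong (_* χ S y) (χ-⊕ S x v))))))) ⟩
      (𝔼[ x ∈ cube d ] 𝔼[ y ∈ cube d ] F x * (F y * χ S ((x ⊕ v) ⊕ y))) ∎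
    contract : ∀ x → (𝔼[ S ∈ cube d ] 𝔼[ y ∈ cube d ] F x * (F y * χ S ((x ⊕ v) ⊕ y))) ≡
                     ½ ^ d * (F x * F (x ⊕ v))
    contract x = begin
      (𝔼[ S ∈ cube d ] 𝔼[ y ∈ cube d ] F x * (F y * χ S ((x ⊕ v) ⊕ y)))
        ≡⟨ 𝔼-swap (cube d) (cube d) (λ S y → F x * (F y * χ S ((x ⊕ v) ⊕ y))) ⟩
      (𝔼[ y ∈ cube d ] 𝔼[ S ∈ cube d ] F x * (F y * χ S ((x ⊕ v) ⊕ y)))
        ≡⟨ 𝔼-cong (cube d) (λ y → trans (𝔼-*ˡ (cube d) (F x) (λ S → F y * χ S ((x ⊕ v) ⊕ y)))
             (cong (F x *_) (trans (𝔼-*ˡ (cube d) (F y) (λ S → χ S ((x ⊕ v) ⊕ y)))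
             (trans (cong (F y *_) (𝔼-χ ((x ⊕ v) ⊕ y))) (*-comm (F y) (δ ((x ⊕ v) ⊕ y))))))) ⟩
      (𝔼[ y ∈ cube d ] F x * (δ ((x ⊕ v) ⊕ y) * F y))
        ≡⟨ 𝔼-*ˡ (cube d) (F x) (λ y → δ ((x ⊕ v) ⊕ y) * F y) ⟩
      F x * (𝔼[ y ∈ cube d ] δ ((x ⊕ v) ⊕ y) * F y)
        ≡⟨ cong (F x *_) (𝔼-δ* (x ⊕ v) F) ⟩
      F x * (½ ^ d * F (x ⊕ v))
        ≡⟨ lemma (F x) (½ ^ d) (F (x ⊕ v)) ⟩
      ½ ^ d * (F x * F (x ⊕ v)) ∎
      where
      lemma : ∀ a b c → a * (b * c) ≡ b * (a * c)
      lemma = solve-∀ ring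

-- The probability that a violation is missed

⊕-telescope : ∀ {d} (x u v : Vec Bool d) → (x ⊕ u) ⊕ (u ⊕ v) ≡ x ⊕ v
⊕-telescope []      []      []      = refl
⊕-telescope (a ∷ x) (b ∷ u) (c ∷ v) = cong₂ _∷_ (lemma a b c) (⊕-telescope x u v)
  where
  lemma : ∀ a b c → (a xor b) xor (b xor c) ≡ a xor c
  lemma false false c     = refl
  lemma false true  false = refl
  lemma false true  true  = refl
  lemma true  false c     = refl
  lemma true  true  c     = refl

χ-0 : ∀ {d} (S : Vec Bool d) → χ S (Vec.replicate d false) ≡ 1ℚ
χ-0 []      = refl
χ-0 (b ∷ S) = trans (χ-∷ b false S (Vec.replicate _ false))
                    (cong₂ (λ c p → sgn c * p) (𝔹.∧-zeroʳ b) (χ-0 S))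

⊕-0 : ∀ {d} (x : Vec Bool d) → x ⊕ Vec.replicate d false ≡ x
⊕-0 = zipWith-identityʳ 𝔹.xor-identityʳ

sgn-sq : ∀ b → sgn b * sgn b ≡ 1ℚ
sgn-sq false = refl
sgn-sq true  = refl

-- The product ½ (1 + sgn a) · ½ (1 + sgn b), which is the indicator that both bits are `false`,
-- multiplied out so that expectations can be taken term by term.
no-violation : Bool → Bool → ℚ
no-violation a b = ℤ.+ 1 / 4 * (1ℚ + (sgn a + (sgn b + sgn a * sgn b)))

infixr 7 _∙_

-- This is u_I of the overview: the row vector I times the matrix with rows z over the field with
-- two elements.
_∙_ : ∀ {n d} → Vec Bool n → Vec (Vec Bool d) n → Vec Bool d
[]          ∙ []      = Vec.replicate _ false
(false ∷ I) ∙ (x ∷ z) = I ∙ z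
(true  ∷ I) ∙ (x ∷ z) = x ⊕ I ∙ z

module _ {d : ℕ} (f : Vec Bool d → Bool) where

  -- The indicator of F(x) = χ_S(x) as a polynomial. Its mean is ½ (1 + F̂(S)), and it is exactly
  -- the factor that one coordinate of I contributes in `𝔼-χ∙`.
  agreement : Vec Bool d → Vec Bool d → ℚ
  agreement S x = ½ * (1ℚ + χ S x * sgn (f x))

  agreement-01 : ∀ S x → agreement S x ≡ 0ℚ ⊎ agreement S x ≡ 1ℚ
  agreement-01 S x with ⊕[ S ] x | f x
  ... | false | false = inj₂ refl
  ... | false | true  = inj₁ refl
  ... | true  | false = inj₁ refl
  ... | true  | true  = inj₂ refl

  0≤agreement : ∀ S x → 0ℚ ≤ agreement S x
  0≤agreement S x with agreement-01 S x
  ... | inj₁ eq = ≤-reflexive (sym eq)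
  ... | inj₂ eq = subst (0ℚ ≤_) (sym eq) (nonNegative⁻¹ 1ℚ)

  matches : ∀ {n} → Vec Bool d → Vec (Vec Bool d) n → ℚ
  matches S []      = 1ℚ
  matches S (x ∷ z) = agreement S x * matches S z

  matches-idem : ∀ {n} S (z : Vec (Vec Bool d) n) → matches S z * matches S z ≡ matches S z
  matches-idem S []      = refl
  matches-idem S (x ∷ z) = trans
    (lemma (agreement S x) (matches S z))
    (cong₂ _*_ (idem (agreement-01 S x)) (matches-idem S z))
    where
    lemma : ∀ a b → a * b * (a * b) ≡ a * a * (b * b)
    lemma = solve-∀ ring
    idem : ∀ {a} → a ≡ 0ℚ ⊎ a ≡ 1ℚ → a * a ≡ a
    idem (inj₁ refl) = refl
    idem (inj₂ refl) = refl

  𝔼-matches : ∀ n S → (𝔼[ z ∈ vectors (cube d) n ] matches S z) ≡ 𝔼 (cube d) (agreement S) ^ n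
  𝔼-matches zero    S = 𝔼-[] (cube d) (matches S)
  𝔼-matches (suc n) S = begin
    (𝔼[ z ∈ vectors (cube d) (suc n) ] matches S z)
      ≡⟨ 𝔼-∷ (cube d) n (matches S) ⟩
    (𝔼[ x ∈ cube d ] 𝔼[ z ∈ vectors (cube d) n ] agreement S x * matches S z)
      ≡⟨ 𝔼-cong (cube d) (λ x → 𝔼-*ˡ (vectors (cube d) n) (agreement S x) (matches S)) ⟩
    (𝔼[ x ∈ cube d ] agreement S x * (𝔼[ z ∈ vectors (cube d) n ] matches S z))
      ≡⟨ 𝔼-*ʳ (cube d) (𝔼[ z ∈ vectors (cube d) n ] matches S z) (agreement S) ⟩
    𝔼 (cube d) (agreement S) * (𝔼[ z ∈ vectors (cube d) n ] matches S z)
      ≡⟨ cong (𝔼 (cube d) (agreement S) *_) (𝔼-matches n S) ⟩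
    𝔼 (cube d) (agreement S) ^ suc n ∎
    where open ≡-Reasoning

  -- The average over I factorises over the coordinates: leaving out zᵢ contributes 1, including it
  -- contributes χ_S(zᵢ) F(zᵢ), and half the sum is the agreement at zᵢ.
  𝔼-χ∙ : ∀ {n} S (z : Vec (Vec Bool d) n) →
         (𝔼[ I ∈ cube n ] χ S (I ∙ z) * χ I (Vec.map f z)) ≡ matches S z
  𝔼-χ∙ S []      = trans (𝔼-cube₀ (λ I → χ S (I ∙ []) * χ I [])) (cong (_* 1ℚ) (χ-0 S))
  𝔼-χ∙ {suc n} S (x ∷ z) = begin
    (𝔼[ I ∈ cube (suc n) ] χ S (I ∙ (x ∷ z)) * χ I (Vec.map f (x ∷ z)))
      ≡⟨ 𝔼-cube₊ n (λ I → χ S (I ∙ (x ∷ z)) * χ I (Vec.map f (x ∷ z))) ⟩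
    ½ * (m + (𝔼[ I ∈ cube n ] χ S (x ⊕ I ∙ z) * χ (true ∷ I) (f x ∷ Vec.map f z)))
      ≡⟨ cong (λ ◌ → ½ * (m + ◌)) (trans (𝔼-cong (cube n) split)
           (𝔼-*ˡ (cube n) (χ S x * sgn (f x)) (λ I → χ S (I ∙ z) * χ I (Vec.map f z)))) ⟩
    ½ * (m + χ S x * sgn (f x) * m)
      ≡⟨ factor m (χ S x * sgn (f x)) ⟩
    agreement S x * m
      ≡⟨ cong (agreement S x *_) (𝔼-χ∙ S z) ⟩
    matches S (x ∷ z) ∎
    where
    open ≡-Reasoning
    m = 𝔼[ I ∈ cube n ] χ S (I ∙ z) * χ I (Vec.map f z)
    factor : ∀ a b → ½ * (a + b * a) ≡ ½ * (1ℚ + b) * a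
    factor = solve-∀ ring
    interchange : ∀ a b c e → a * b * (c * e) ≡ a * c * (b * e)
    interchange = solve-∀ ring
    split : ∀ I → χ S (x ⊕ I ∙ z) * χ (true ∷ I) (f x ∷ Vec.map f z) ≡
                  χ S x * sgn (f x) * (χ S (I ∙ z) * χ I (Vec.map f z))
    split I = trans
      (cong₂ _*_ (χ-⊕ S x (I ∙ z)) (χ-∷ true (f x) I (Vec.map f z)))
      (interchange (χ S x) (χ S (I ∙ z)) (sgn (f x)) (χ I (Vec.map f z)))

  -- The character of u_I ⊕ u_J splits, so the double average is the square of the single one. That
  -- one is 0 or 1, hence equal to its square, and the product of two checks costs no more than one
  -- check.
  𝔼-χ∙∙ : ∀ {n} S (z : Vec (Vec Bool d) n) →
          (𝔼[ I ∈ cube n ] 𝔼[ J ∈ cube n ]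
            χ S (I ∙ z ⊕ J ∙ z) * (χ I (Vec.map f z) * χ J (Vec.map f z))) ≡ matches S z
  𝔼-χ∙∙ {n} S z = begin
    (𝔼[ I ∈ cube n ] 𝔼[ J ∈ cube n ] χ S (I ∙ z ⊕ J ∙ z) * (χ I (Vec.map f z) * χ J (Vec.map f z)))
      ≡⟨ 𝔼-cong (cube n) (λ I → trans (𝔼-cong (cube n) (split I)) (𝔼-*ˡ (cube n) (g I) g)) ⟩
    (𝔼[ I ∈ cube n ] g I * 𝔼 (cube n) g)
      ≡⟨ 𝔼-*ʳ (cube n) (𝔼 (cube n) g) g ⟩
    𝔼 (cube n) g * 𝔼 (cube n) g
      ≡⟨ cong₂ _*_ (𝔼-χ∙ S z) (𝔼-χ∙ S z) ⟩
    matches S z * matches S z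
      ≡⟨ matches-idem S z ⟩
    matches S z ∎
    where
    open ≡-Reasoning
    g : Vec Bool n → ℚ
    g I = χ S (I ∙ z) * χ I (Vec.map f z)
    interchange : ∀ a b c e → a * b * (c * e) ≡ a * c * (b * e)
    interchange = solve-∀ ring
    split : ∀ I J → χ S (I ∙ z ⊕ J ∙ z) * (χ I (Vec.map f z) * χ J (Vec.map f z)) ≡ g I * g J
    split I J = trans (cong (_* (χ I (Vec.map f z) * χ J (Vec.map f z))) (χ-⊕ S (I ∙ z) (J ∙ z)))
      (interchange (χ S (I ∙ z)) (χ S (J ∙ z)) (χ I (Vec.map f z)) (χ J (Vec.map f z)))

  private
    F : Vec Bool d → ℚ
    F x = sgn (f x)

    0<½^ : ∀ d → Positive (½ ^ d)
    0<½^ zero    = _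
    0<½^ (suc d) = pos*pos⇒pos ½ (½ ^ d) {{0<½^ d}}

  parseval : (𝔼[ S ∈ cube d ] coefficient F S * coefficient F S) ≡ ½ ^ d
  parseval = begin
    (𝔼[ S ∈ cube d ] coefficient F S * coefficient F S)
      ≡⟨ 𝔼-cong (cube d) (λ S → trans (sym (*-identityʳ (coefficient F S * coefficient F S)))
           (cong (coefficient F S * coefficient F S *_) (sym (χ-0 S)))) ⟩
    (𝔼[ S ∈ cube d ] coefficient F S * coefficient F S * χ S (Vec.replicate d false))
      ≡⟨ wiener-khinchin F (Vec.replicate d false) ⟩
    ½ ^ d * (𝔼[ x ∈ cube d ] F x * F (x ⊕ Vec.replicate d false))
      ≡⟨ cong (½ ^ d *_) (trans (𝔼-cong (cube d) (λ x → trans (cong (λ y → F x * F y) (⊕-0 x)) (sgn-sq (f x))))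
           (𝔼-const (cube d) 1ℚ)) ⟩
    ½ ^ d * 1ℚ
      ≡⟨ *-identityʳ (½ ^ d) ⟩
    ½ ^ d ∎
    where open ≡-Reasoning

  -- Σ_S F̂(S)² = 1, so an average of autocorrelations is a convex combination of averages of characters.
  autocorrelation-bound : ∀ Ω (u : Carrier Ω → Vec Bool d) (w : Carrier Ω → ℚ) β →
    (∀ S → (𝔼[ ω ∈ Ω ] χ S (u ω) * w ω) ≤ β) →
    (𝔼[ ω ∈ Ω ] autocorrelation F (u ω) * w ω) ≤ β
  autocorrelation-bound Ω u w β bound = *-cancelˡ-≤-pos (½ ^ d) {{0<½^ d}} (begin
    ½ ^ d * (𝔼[ ω ∈ Ω ] autocorrelation F (u ω) * w ω)
      ≡⟨ 𝔼-*ˡ Ω (½ ^ d) (λ ω → autocorrelation F (u ω) * w ω) ⟨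
    (𝔼[ ω ∈ Ω ] ½ ^ d * (autocorrelation F (u ω) * w ω))
      ≡⟨ 𝔼-cong Ω (λ ω → trans (sym (*-assoc (½ ^ d) (autocorrelation F (u ω)) (w ω)))
           (trans (cong (_* w ω) (sym (wiener-khinchin F (u ω))))
           (trans (sym (𝔼-*ʳ (cube d) (w ω) (λ S → c² S * χ S (u ω))))
           (𝔼-cong (cube d) (λ S → *-assoc (c² S) (χ S (u ω)) (w ω)))))) ⟩
    (𝔼[ ω ∈ Ω ] 𝔼[ S ∈ cube d ] c² S * (χ S (u ω) * w ω))
      ≡⟨ 𝔼-swap Ω (cube d) (λ ω S → c² S * (χ S (u ω) * w ω)) ⟩
    (𝔼[ S ∈ cube d ] 𝔼[ ω ∈ Ω ] c² S * (χ S (u ω) * w ω))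
      ≡⟨ 𝔼-cong (cube d) (λ S → 𝔼-*ˡ Ω (c² S) (λ ω → χ S (u ω) * w ω)) ⟩
    (𝔼[ S ∈ cube d ] c² S * (𝔼[ ω ∈ Ω ] χ S (u ω) * w ω))
      ≤⟨ 𝔼-mono (cube d) (λ S → *-monoˡ (0≤sq (coefficient F S)) (bound S)) ⟩
    (𝔼[ S ∈ cube d ] c² S * β)
      ≡⟨ 𝔼-*ʳ (cube d) β c² ⟩
    𝔼 (cube d) c² * β
      ≡⟨ cong (_* β) parseval ⟩
    ½ ^ d * β ∎)
    where
    open ≤-Reasoning
    c² : Vec Bool d → ℚ
    c² S = coefficient F S * coefficient F S

  -- Substitute y = x ⊕ u: the second argument becomes y ⊕ (u ⊕ v).
  𝔼-shifts : ∀ u v → (𝔼[ x ∈ cube d ] F (x ⊕ u) * F (x ⊕ v)) ≡ autocorrelation F (u ⊕ v)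
  𝔼-shifts u v = trans
    (𝔼-cong (cube d) (λ x → cong (λ y → F (x ⊕ u) * F y) (sym (⊕-telescope x u v))))
    (𝔼-shift u (λ y → F y * F (y ⊕ (u ⊕ v))))

  violation : ∀ {n} → Vec (Vec Bool d) n → Vec Bool d → Vec Bool n → Bool
  violation z x I = (f x xor f (x ⊕ I ∙ z)) xor ⊕[ I ] (Vec.map f z)

  passes : ∀ {n} → Vec (Vec Bool d) n → Vec Bool d → Vec Bool n → Vec Bool n → ℚ
  passes z x I J = no-violation (violation z x I) (violation z x J)

  -- Averaging over x first turns the three non-constant terms of `no-violation` into
  -- autocorrelations, weighted by signs that do not involve x. By `autocorrelation-bound` it
  -- suffices to treat one character S at a time; there the average over the subsets is
  -- `matches S z`, whose mean over z is at most κ ^ n.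
  𝔼-passes : ∀ n κ → (∀ S → 𝔼 (cube d) (agreement S) ≤ κ) →
    (𝔼[ z ∈ vectors (cube d) n ] 𝔼[ I ∈ cube n ] 𝔼[ J ∈ cube n ] 𝔼[ x ∈ cube d ] passes z x I J) ≤
    ℤ.+ 1 / 4 * (1ℚ + (κ ^ n + (κ ^ n + κ ^ n)))
  𝔼-passes n κ bound = begin
    (𝔼[ z ∈ Z ] 𝔼[ I ∈ cube n ] 𝔼[ J ∈ cube n ] 𝔼[ x ∈ cube d ] passes z x I J)
      ≡⟨ 𝔼-⊗⊗ (λ z I J → 𝔼[ x ∈ cube d ] passes z x I J) ⟨
    (𝔼[ (z , I , J) ∈ Ω ] 𝔼[ x ∈ cube d ] passes z x I J)
      ≡⟨ 𝔼-cong Ω (λ (z , I , J) → 𝔼x-passes z I J) ⟩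
    (𝔼[ ω ∈ Ω ] ¼ * (1ℚ + (A ω + (B ω + C ω))))
      ≡⟨ 𝔼-*ˡ Ω ¼ (λ ω → 1ℚ + (A ω + (B ω + C ω))) ⟩
    ¼ * (𝔼[ ω ∈ Ω ] 1ℚ + (A ω + (B ω + C ω)))
      ≡⟨ cong (¼ *_) (𝔼-1+++ Ω A B C) ⟩
    ¼ * (1ℚ + (𝔼 Ω A + (𝔼 Ω B + 𝔼 Ω C)))
      ≤⟨ *-monoˡ {r = ¼} (0≤+/ 1 4) (+-monoʳ-≤ 1ℚ (+-mono-≤ 𝔼A≤ (+-mono-≤ 𝔼B≤ 𝔼C≤))) ⟩
    ¼ * (1ℚ + (κ ^ n + (κ ^ n + κ ^ n))) ∎
    where
    open ≤-Reasoning
    Z = vectors (cube d) n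
    Ω = Z ⊗ cube n ⊗ cube n
    ¼ = ℤ.+ 1 / 4
    A B C : Carrier Ω → ℚ
    A (z , I , J) = autocorrelation F (I ∙ z) * χ I (Vec.map f z)
    B (z , I , J) = autocorrelation F (J ∙ z) * χ J (Vec.map f z)
    C (z , I , J) = autocorrelation F (I ∙ z ⊕ J ∙ z) * (χ I (Vec.map f z) * χ J (Vec.map f z))
    𝔼-⊗⊗ : ∀ (g : Vec (Vec Bool d) n → Vec Bool n → Vec Bool n → ℚ) →
      (𝔼[ (z , I , J) ∈ Ω ] g z I J) ≡ (𝔼[ z ∈ Z ] 𝔼[ I ∈ cube n ] 𝔼[ J ∈ cube n ] g z I J)
    𝔼-⊗⊗ g = trans (𝔼-⊗ Z (cube n ⊗ cube n) (λ (z , I , J) → g z I J))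
      (𝔼-cong Z (λ z → 𝔼-⊗ (cube n) (cube n) (λ (I , J) → g z I J)))
    𝔼-1+++ : ∀ Ω g h k → (𝔼[ ω ∈ Ω ] 1ℚ + (g ω + (h ω + k ω))) ≡ 1ℚ + (𝔼 Ω g + (𝔼 Ω h + 𝔼 Ω k))
    𝔼-1+++ Ω g h k =
      trans (𝔼-+ Ω (λ _ → 1ℚ) (λ ω → g ω + (h ω + k ω))) (cong₂ _+_ (𝔼-const Ω 1ℚ)
      (trans (𝔼-+ Ω g (λ ω → h ω + k ω)) (cong (𝔼 Ω g +_) (𝔼-+ Ω h k))))
    𝔼x-passes : ∀ z I J → (𝔼[ x ∈ cube d ] passes z x I J) ≡
                ¼ * (1ℚ + (A (z , I , J) + (B (z , I , J) + C (z , I , J))))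
    𝔼x-passes z I J =
      trans (𝔼-*ˡ (cube d) ¼ (λ x → 1ℚ + (a x + (b x + a x * b x)))) (cong (¼ *_)
      (trans (𝔼-1+++ (cube d) a b (λ x → a x * b x)) (cong (1ℚ +_)
      (cong₂ _+_ (𝔼-violation I) (cong₂ _+_ (𝔼-violation J)
      (trans (𝔼-cong (cube d) ab)
      (trans (𝔼-*ʳ (cube d) (p * q) (λ x → F (x ⊕ I ∙ z) * F (x ⊕ J ∙ z)))
      (cong (_* (p * q)) (𝔼-shifts (I ∙ z) (J ∙ z))))))))))
      where
      a b : Vec Bool d → ℚ
      a x = sgn (violation z x I)
      b x = sgn (violation z x J)
      p = χ I (Vec.map f z)
      q = χ J (Vec.map f z)
      sgn-violation : ∀ x I → sgn (violation z x I) ≡ F x * F (x ⊕ I ∙ z) * χ I (Vec.map f z)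
      sgn-violation x I = trans (sgn-xor (f x xor f (x ⊕ I ∙ z)) (⊕[ I ] (Vec.map f z)))
        (cong (_* χ I (Vec.map f z)) (sgn-xor (f x) (f (x ⊕ I ∙ z))))
      𝔼-violation : ∀ I → (𝔼[ x ∈ cube d ] sgn (violation z x I)) ≡
                    autocorrelation F (I ∙ z) * χ I (Vec.map f z)
      𝔼-violation I = trans (𝔼-cong (cube d) (λ x → sgn-violation x I))
        (𝔼-*ʳ (cube d) (χ I (Vec.map f z)) (λ x → F x * F (x ⊕ I ∙ z)))
      rearrange : ∀ s u v p q → s * u * p * (s * v * q) ≡ s * s * (u * v * (p * q))
      rearrange = solve-∀ ring
      -- Both checks contain F(x), and its square is 1.
      ab : ∀ x → a x * b x ≡ F (x ⊕ I ∙ z) * F (x ⊕ J ∙ z) * (p * q)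
      ab x = trans (cong₂ _*_ (sgn-violation x I) (sgn-violation x J))
        (trans (rearrange (F x) (F (x ⊕ I ∙ z)) (F (x ⊕ J ∙ z)) p q)
        (trans (cong (_* (F (x ⊕ I ∙ z) * F (x ⊕ J ∙ z) * (p * q))) (sgn-sq (f x)))
        (*-identityˡ (F (x ⊕ I ∙ z) * F (x ⊕ J ∙ z) * (p * q)))))
    𝔼-matches≤ : ∀ S → 𝔼 Z (matches S) ≤ κ ^ n
    𝔼-matches≤ S = ≤-trans (≤-reflexive (𝔼-matches n S))
      (^-monoˡ n (subst (_≤ 𝔼 (cube d) (agreement S)) (𝔼-const (cube d) 0ℚ)
        (𝔼-mono (cube d) (0≤agreement S))) (bound S))
    𝔼A≤ : 𝔼 Ω A ≤ κ ^ n
    𝔼A≤ = autocorrelation-bound Ω (λ (z , I , J) → I ∙ z) (λ (z , I , J) → χ I (Vec.map f z)) (κ ^ n)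
      λ S → ≤-trans (≤-reflexive (trans (𝔼-⊗⊗ (λ z I J → χ S (I ∙ z) * χ I (Vec.map f z)))
        (𝔼-cong Z (λ z → trans
          (𝔼-cong (cube n) (λ I → 𝔼-const (cube n) (χ S (I ∙ z) * χ I (Vec.map f z))))
          (𝔼-χ∙ S z))))) (𝔼-matches≤ S)
    𝔼B≤ : 𝔼 Ω B ≤ κ ^ n
    𝔼B≤ = autocorrelation-bound Ω (λ (z , I , J) → J ∙ z) (λ (z , I , J) → χ J (Vec.map f z)) (κ ^ n)
      λ S → ≤-trans (≤-reflexive (trans (𝔼-⊗⊗ (λ z I J → χ S (J ∙ z) * χ J (Vec.map f z)))
        (𝔼-cong Z (λ z → trans
          (𝔼-const (cube n) (𝔼[ J ∈ cube n ] χ S (J ∙ z) * χ J (Vec.map f z)))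
          (𝔼-χ∙ S z))))) (𝔼-matches≤ S)
    𝔼C≤ : 𝔼 Ω C ≤ κ ^ n
    𝔼C≤ = autocorrelation-bound Ω (λ (z , I , J) → I ∙ z ⊕ J ∙ z)
      (λ (z , I , J) → χ I (Vec.map f z) * χ J (Vec.map f z)) (κ ^ n)
      λ S → ≤-trans (≤-reflexive (trans
        (𝔼-⊗⊗ (λ z I J → χ S (I ∙ z ⊕ J ∙ z) * (χ I (Vec.map f z) * χ J (Vec.map f z))))
        (𝔼-cong Z (𝔼-χ∙∙ S)))) (𝔼-matches≤ S)

-- Collisions of random subset sums

collision : ∀ {n d} → Vec (Vec Bool d) n → ℚ
collision {n} z = 𝔼[ I ∈ cube n ] 𝔼[ J ∈ cube n ] δ (I ∙ z ⊕ J ∙ z)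

0≤½^ : ∀ n → 0ℚ ≤ ½ ^ n
0≤½^ n = 0≤^ n (nonNegative⁻¹ ½)

1^ : ∀ n → 1ℚ ^ n ≡ 1ℚ
1^ zero    = refl
1^ (suc n) = trans (*-identityˡ (1ℚ ^ n)) (1^ n)

δ-01 : ∀ {d} (v : Vec Bool d) → δ v ≡ 0ℚ ⊎ δ v ≡ 1ℚ
δ-01 []          = inj₂ refl
δ-01 (false ∷ v) = δ-01 v
δ-01 (true  ∷ v) = inj₁ refl

0≤δ : ∀ {d} (v : Vec Bool d) → 0ℚ ≤ δ v
0≤δ v with δ-01 v
... | inj₁ eq = ≤-reflexive (sym eq)
... | inj₂ eq = subst (0ℚ ≤_) (sym eq) (nonNegative⁻¹ 1ℚ)

-- Expanding δ in characters makes this the count of matches for the zero function.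
𝔼-collision : ∀ n d → (𝔼[ z ∈ vectors (cube d) n ] collision z) ≤ ½ ^ n + ½ ^ d
𝔼-collision n d = begin
  (𝔼[ z ∈ Z ] collision z)
    ≡⟨ 𝔼-cong Z collision≡ ⟩
  (𝔼[ z ∈ Z ] 𝔼[ S ∈ cube d ] matches zero-function S z)
    ≡⟨ 𝔼-swap Z (cube d) (λ z S → matches zero-function S z) ⟩
  (𝔼[ S ∈ cube d ] 𝔼[ z ∈ Z ] matches zero-function S z)
    ≡⟨ 𝔼-cong (cube d) (λ S → trans (𝔼-matches zero-function n S) (cong (_^ n) (𝔼-agreement S))) ⟩
  (𝔼[ S ∈ cube d ] (½ * (1ℚ + δ S)) ^ n)
    ≤⟨ 𝔼-mono (cube d) (λ S → power (δ-01 S)) ⟩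
  (𝔼[ S ∈ cube d ] ½ ^ n + δ S)
    ≡⟨ 𝔼-+ (cube d) (λ _ → ½ ^ n) δ ⟩
  (𝔼[ S ∈ cube d ] ½ ^ n) + 𝔼 (cube d) δ
    ≡⟨ cong₂ _+_ (𝔼-const (cube d) (½ ^ n)) (trans
         (𝔼-cong (cube d) (λ S → cong δ (sym (zipWith-identityˡ 𝔹.xor-identityˡ S))))
         (𝔼-δ (Vec.replicate d false))) ⟩
  ½ ^ n + ½ ^ d ∎
  where
  open ≤-Reasoning
  Z = vectors (cube d) n
  zero-function : Vec Bool d → Bool
  zero-function _ = false
  χ-zero : ∀ {n} I (z : Vec (Vec Bool d) n) → χ I (Vec.map zero-function z) ≡ 1ℚ
  χ-zero []      []      = refl
  χ-zero (b ∷ I) (x ∷ z) = trans (χ-∷ b false I (Vec.map zero-function z))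
    (cong₂ (λ c p → sgn c * p) (𝔹.∧-zeroʳ b) (χ-zero I z))
  collision≡ : ∀ z → collision z ≡ (𝔼[ S ∈ cube d ] matches zero-function S z)
  collision≡ z = begin-equality
    (𝔼[ I ∈ cube n ] 𝔼[ J ∈ cube n ] δ (I ∙ z ⊕ J ∙ z))
      ≡⟨ 𝔼-cong (cube n) (λ I → 𝔼-cong (cube n) (λ J → sym (trans
           (𝔼-cong (cube d) (λ S → trans
             (cong₂ (λ p q → χ S (I ∙ z ⊕ J ∙ z) * (p * q)) (χ-zero I z) (χ-zero J z))
             (*-identityʳ (χ S (I ∙ z ⊕ J ∙ z)))))
           (𝔼-χ (I ∙ z ⊕ J ∙ z))))) ⟩
    (𝔼[ I ∈ cube n ] 𝔼[ J ∈ cube n ] 𝔼[ S ∈ cube d ] g S I J)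
      ≡⟨ 𝔼-cong (cube n) (λ I → 𝔼-swap (cube n) (cube d) (λ J S → g S I J)) ⟩
    (𝔼[ I ∈ cube n ] 𝔼[ S ∈ cube d ] 𝔼[ J ∈ cube n ] g S I J)
      ≡⟨ 𝔼-swap (cube n) (cube d) (λ I S → 𝔼[ J ∈ cube n ] g S I J) ⟩
    (𝔼[ S ∈ cube d ] 𝔼[ I ∈ cube n ] 𝔼[ J ∈ cube n ] g S I J)
      ≡⟨ 𝔼-cong (cube d) (λ S → 𝔼-χ∙∙ zero-function S z) ⟩
    (𝔼[ S ∈ cube d ] matches zero-function S z) ∎
    where
    g : Vec Bool d → Vec Bool n → Vec Bool n → ℚ
    g S I J = χ S (I ∙ z ⊕ J ∙ z) * (χ I (Vec.map zero-function z) * χ J (Vec.map zero-function z))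
  𝔼-agreement : ∀ S → 𝔼 (cube d) (agreement zero-function S) ≡ ½ * (1ℚ + δ S)
  𝔼-agreement S = trans (𝔼-*ˡ (cube d) ½ (λ x → 1ℚ + χ S x * 1ℚ)) (cong (½ *_)
    (trans (𝔼-+ (cube d) (λ _ → 1ℚ) (λ x → χ S x * 1ℚ)) (cong₂ _+_ (𝔼-const (cube d) 1ℚ)
    (trans (𝔼-cong (cube d) (λ x → trans (*-identityʳ (χ S x)) (χ-comm S x))) (𝔼-χ S)))))
  -- Only S = 0 agrees with the zero function everywhere. It has base 1 instead of ½ and is absorbed
  -- by a, whose mean over S is ½ ^ d.
  power : ∀ {a} → a ≡ 0ℚ ⊎ a ≡ 1ℚ → (½ * (1ℚ + a)) ^ n ≤ ½ ^ n + a
  power (inj₁ refl) = ≤-reflexive (sym (+-identityʳ (½ ^ n)))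
  power (inj₂ refl) = subst (_≤ ½ ^ n + 1ℚ) (trans (+-identityˡ 1ℚ) (sym (1^ n))) (+-monoˡ-≤ 1ℚ (0≤½^ n))

-- Transitivity of equality in numerical form: e = a and e = b force a = b.
δ-transfer : ∀ {d} (a b e : Vec Bool d) → δ (e ⊕ a) * δ (e ⊕ b) ≤ δ (a ⊕ b)
δ-transfer []          []          []          = ≤-refl
δ-transfer (false ∷ a) (false ∷ b) (false ∷ e) = δ-transfer a b e
δ-transfer (true  ∷ a) (true  ∷ b) (true  ∷ e) = δ-transfer a b e
δ-transfer (false ∷ a) (true  ∷ b) (false ∷ e) = ≤-reflexive (*-zeroʳ (δ (e ⊕ a)))
δ-transfer (true  ∷ a) (false ∷ b) (true  ∷ e) = ≤-reflexive (*-zeroʳ (δ (e ⊕ a)))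
δ-transfer (true  ∷ a) (c     ∷ b) (false ∷ e) = ≤-trans (≤-reflexive (*-zeroˡ (δ (c ∷ e ⊕ b)))) (0≤δ (not c ∷ a ⊕ b))
δ-transfer (false ∷ a) (c     ∷ b) (true  ∷ e) = ≤-trans (≤-reflexive (*-zeroˡ (δ (not c ∷ e ⊕ b)))) (0≤δ (c ∷ a ⊕ b))

-- The probability p of guessing a random subset sum: p² ≤ collision, and p ≤ m + M p² by AM-GM.
guess-bound : ∀ {n d} (z : Vec (Vec Bool d) n) e m M → 0ℚ ≤ m → 0ℚ ≤ M → M * m ≡ 1ℚ →
              (𝔼[ I ∈ cube n ] δ (e ⊕ I ∙ z)) ≤ m + M * collision z
guess-bound {n} z e m M 0≤m 0≤M Mm≡1 = ≤-trans am-gm (+-monoʳ-≤ m (*-monoˡ 0≤M p²≤))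
  where
  g : Vec Bool n → ℚ
  g I = δ (e ⊕ I ∙ z)
  p = 𝔼 (cube n) g
  p²≤ : p * p ≤ collision z
  p²≤ = subst (_≤ collision z)
    (trans (𝔼-cong (cube n) (λ I → 𝔼-*ˡ (cube n) (g I) g)) (𝔼-*ʳ (cube n) p g))
    (𝔼-mono (cube n) (λ I → 𝔼-mono (cube n) (λ J → δ-transfer (I ∙ z) (J ∙ z) e)))
  -- Stands in for taking a square root, which would leave ℚ. As M m = 1, the difference of the two
  -- sides is m ((M p - ½)² + ¾).
  am-gm : p ≤ m + M * (p * p)
  am-gm = 0≤-⇒≤ (subst (0ℚ ≤_)
    (trans (expand m M p) (collapse Mm≡1))
    (0≤* 0≤m (0≤+ (0≤sq (M * p - ½)) (0≤+/ 3 4))))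
    where
    expand : ∀ m M p → m * ((M * p - ½) * (M * p - ½) + ℤ.+ 3 / 4) ≡ m + (M * m) * (M * (p * p)) - (M * m) * p
    expand = solve-∀ ring
    collapse : ∀ {k} → k ≡ 1ℚ → m + k * (M * (p * p)) - k * p ≡ m + M * (p * p) - p
    collapse refl = cong₂ (λ a b → m + a - b) (*-identityˡ (M * (p * p))) (*-identityˡ p)

-- Erasures

module _ {D R : Set} where

  -- After an erased answer the remaining points are still asked, now with the verdict fixed to
  -- accept, so that the queries do not depend on the answers.
  ask : ∀ {m} → Vec D m → (Vec R m → Bool) → DecisionTree D R
  ask []       φ = output (φ [])
  ask (x ∷ xs) φ = query x λ where
    nothing  → ask xs (λ _ → true)
    (just y) → ask xs (λ ys → φ (y ∷ ys))

  ask-asks : ∀ {m} (xs : Vec D m) φ → Asks (Vec.toList xs) (ask xs φ)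
  ask-asks []       φ = output
  ask-asks (x ∷ xs) φ = query λ where
    nothing  → ask-asks xs (λ _ → true)
    (just y) → ask-asks xs (λ ys → φ (y ∷ ys))

  ask-asksAtMost : ∀ {m} (xs : Vec D m) φ → AsksAtMost m (ask xs φ)
  ask-asksAtMost []       φ = output
  ask-asksAtMost (x ∷ xs) φ = query λ where
    nothing  → ask-asksAtMost xs (λ _ → true)
    (just y) → ask-asksAtMost xs (λ ys → φ (y ∷ ys))

1≤indicator : ∀ {P : Set} (P? : Dec P) → P → 1ℚ ≤ indicator P?
1≤indicator (yes _) _ = ≤-refl
1≤indicator (no ¬p) p = contradiction p ¬p

𝔼-∑ : ∀ Ω {A : Set} (xs : List A) (g : Carrier Ω → A → ℚ) →
      (𝔼[ ω ∈ Ω ] ∑ xs (g ω)) ≡ ∑ xs (λ x → 𝔼[ ω ∈ Ω ] g ω x)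
𝔼-∑ Ω []       g = 𝔼-const Ω 0ℚ
𝔼-∑ Ω (x ∷ xs) g = trans (𝔼-+ Ω (λ ω → g ω x) (λ ω → ∑ xs (g ω)))
                         (cong (λ ◌ → (𝔼[ ω ∈ Ω ] g ω x) + ◌) (𝔼-∑ Ω xs g))

𝔼-≤ : ∀ Ω {g : Carrier Ω → ℚ} {c} → (∀ ω → g ω ≤ c) → 𝔼 Ω g ≤ c
𝔼-≤ Ω {g} {c} le = subst (𝔼 Ω g ≤_) (𝔼-const Ω c) (𝔼-mono Ω le)

length-toList≤ : ∀ {A : Set} {t} (v : Vec≤ A t) → length (Vec≤.toList v) ℕ.≤ t
length-toList≤ v = ℕ.≤-trans (ℕ.≤-reflexive (length-toList (Vec≤.toVec v))) (Vec≤.isBounded v)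

∑-nonNeg : ∀ {A : Set} (xs : List A) {g : A → ℚ} → (∀ x → 0ℚ ≤ g x) → 0ℚ ≤ ∑ xs g
∑-nonNeg []       0≤g = ≤-refl
∑-nonNeg (x ∷ xs) 0≤g = 0≤+ (0≤g x) (∑-nonNeg xs 0≤g)

δ-refl : ∀ {d} (x : Vec Bool d) → δ (x ⊕ x) ≡ 1ℚ
δ-refl []          = refl
δ-refl (false ∷ x) = δ-refl x
δ-refl (true  ∷ x) = δ-refl x

module _ {d : ℕ} where

  private
    V = Vec Bool d

  -- Counts x in the list with multiplicity. This majorises the indicator of membership and is
  -- additive in the list, which builds in the union bound over erasures.
  hits : List V → V → ℚ
  hits er x = ∑ er (λ e → δ (e ⊕ x))

  0≤hits : ∀ er x → 0ℚ ≤ hits er x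
  0≤hits er x = ∑-nonNeg er (λ e → 0≤δ (e ⊕ x))

  ∈⇒1≤hits : ∀ {er x} → x ∈ er → 1ℚ ≤ hits er x
  ∈⇒1≤hits {e ∷ er} {x} (here refl) = subst (_≤ hits (e ∷ er) x) (trans (+-identityʳ (δ (x ⊕ x))) (δ-refl x))
    (+-monoʳ-≤ (δ (x ⊕ x)) (0≤hits er x))
  ∈⇒1≤hits {e ∷ er} {x} (there x∈er) = subst (_≤ hits (e ∷ er) x) (+-identityˡ 1ℚ)
    (+-mono-≤ (0≤δ (e ⊕ x)) (∈⇒1≤hits x∈er))

  𝔼-hits : ∀ er → 𝔼 (cube d) (hits er) ≡ fromℕ (length er) * ½ ^ d
  𝔼-hits er = trans (𝔼-∑ (cube d) er (λ x e → δ (e ⊕ x)))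
    (trans (∑-cong er 𝔼-δ) (∑-const er (½ ^ d)))

  -- Only the subset I is hidden from an adversary that chooses T.
  𝔼-hits-guess : ∀ {n t} (z : Vec V n) T x → length T ℕ.≤ t →
    (𝔼[ I ∈ cube n ] hits T (x ⊕ I ∙ z)) ≤
    ℤ.+ 1 / 100 + fromℕ 100 * (fromℕ t * fromℕ t) * collision z
  -- The parameter m below contains 1/t, so t = 0 is treated separately.
  𝔼-hits-guess {n} {zero} z [] x _ = begin
    (𝔼[ I ∈ cube n ] 0ℚ)                              ≡⟨ 𝔼-const (cube n) 0ℚ ⟩
    0ℚ                                                ≤⟨ 0≤+/ 1 100 ⟩
    ℤ.+ 1 / 100                                       ≡⟨ +-identityʳ (ℤ.+ 1 / 100) ⟨
    ℤ.+ 1 / 100 + 0ℚ                                  ≡⟨ cong (λ ◌ → ℤ.+ 1 / 100 + ◌) (*-zeroˡ (collision z)) ⟨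
    ℤ.+ 1 / 100 + fromℕ 100 * (fromℕ 0 * fromℕ 0) * collision z ∎
    where open ≤-Reasoning
  𝔼-hits-guess {n} {t@(suc _)} z T x |T|≤t = begin
    (𝔼[ I ∈ cube n ] hits T (x ⊕ I ∙ z))
      ≡⟨ 𝔼-∑ (cube n) T (λ I e → δ (e ⊕ (x ⊕ I ∙ z))) ⟩
    ∑ T (λ e → 𝔼[ I ∈ cube n ] δ (e ⊕ (x ⊕ I ∙ z)))
      ≤⟨ ∑-mono T (λ e → ≤-trans
           (≤-reflexive (𝔼-cong (cube n) (λ I → cong δ (sym (⊕-assoc e x (I ∙ z))))))
           (guess-bound z (e ⊕ x) m M 0≤m 0≤M Mm≡1)) ⟩
    ∑ T (λ _ → m + M * collision z)
      ≡⟨ ∑-const T (m + M * collision z) ⟩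
    fromℕ (length T) * (m + M * collision z)
      ≤⟨ *-monoʳ (0≤+ 0≤m (0≤* 0≤M 0≤collision)) (fromℕ-mono {length T} {t} |T|≤t) ⟩
    τ * (m + M * collision z)
      ≡⟨ expand τ (ℤ.+ 1 / t) (ℤ.+ 1 / 100) (fromℕ 100) (collision z) ⟩
    τ * (ℤ.+ 1 / t) * (ℤ.+ 1 / 100) + fromℕ 100 * (τ * τ) * collision z
      ≡⟨ cong (_+ fromℕ 100 * (τ * τ) * collision z)
           (trans (cong (_* (ℤ.+ 1 / 100)) (1/-*-fromℕ t)) (*-identityˡ (ℤ.+ 1 / 100))) ⟩
    ℤ.+ 1 / 100 + fromℕ 100 * (τ * τ) * collision z ∎
    where
    open ≤-Reasoning
    τ = fromℕ t
    -- Each of the at most t guesses is allowed an additive error 1/(100 t), so together they cost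
    -- 1/100; M is the inverse of m.
    m = (ℤ.+ 1 / t) * (ℤ.+ 1 / 100)
    M = fromℕ 100 * τ
    0≤m = 0≤* (0≤+/ 1 t) (0≤+/ 1 100)
    0≤M = 0≤* (0≤fromℕ 100) (0≤fromℕ t)
    0≤collision : 0ℚ ≤ collision z
    0≤collision = subst (_≤ collision z)
      (trans (𝔼-cong (cube n) (λ _ → 𝔼-const (cube n) 0ℚ)) (𝔼-const (cube n) 0ℚ))
      (𝔼-mono (cube n) (λ I → 𝔼-mono (cube n) (λ J → 0≤δ (I ∙ z ⊕ J ∙ z))))
    swap : ∀ a b c e → a * b * (c * e) ≡ a * e * (b * c)
    swap = solve-∀ ring
    Mm≡1 : M * m ≡ 1ℚ
    Mm≡1 = trans (swap (fromℕ 100) τ (ℤ.+ 1 / t) (ℤ.+ 1 / 100))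
      (trans (cong (λ ◌ → fromℕ 100 * (ℤ.+ 1 / 100) * ◌) (1/-*-fromℕ t)) refl)
    expand : ∀ τ ι a b c → τ * (ι * a + b * τ * c) ≡ τ * ι * a + b * (τ * τ) * c
    expand = solve-∀ ring

  module _ {t : ℕ} (f : V → Bool) (σ : Strategy t V Bool) where

    -- exposure majorises the number of erased queries of the run on which all answers are truthful;
    -- up to the first erased query the actual run is that one.
    exposure : ∀ {m} → Transcript V Bool → List V → Vec V m → ℚ
    exposure h er []       = 0ℚ
    exposure h er (x ∷ xs) = hits er x + exposure h′ (Vec≤.toList (σ h′) List.++ er) xs
      where h′ = (x , just (f x)) ∷ h

    0≤exposure : ∀ {m} h er (xs : Vec V m) → 0ℚ ≤ exposure h er xs
    0≤exposure h er []       = ≤-refl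
    0≤exposure h er (x ∷ xs) = 0≤+ (0≤hits er x) (0≤exposure _ _ xs)

    -- Answers are truthful or erased, and an erasure can only lead to acceptance. This gives
    -- one-sided error against every strategy.
    ask-accepts : ∀ {m} h er (xs : Vec V m) φ → φ (Vec.map f xs) ≡ true →
                  runFrom (cube d) h er σ f (ask xs φ) ≡ true
    ask-accepts h er []       φ eq = eq
    ask-accepts h er (x ∷ xs) φ eq with x ∈? er
      where open import Data.List.Membership.DecPropositional (FiniteSet._≟_ (cube d)) using (_∈?_)
    ... | yes _ = ask-accepts _ _ xs (λ _ → true) refl
    ... | no  _ = ask-accepts _ _ xs (λ ys → φ (f x ∷ ys)) eq

    -- Either every answer is truthful and the run rejects, or the first erased query already
    -- contributes 1 to the exposure.
    ask-rejects : ∀ {m} h er (xs : Vec V m) φ → φ (Vec.map f xs) ≡ false →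
                  1ℚ ≤ indicator (runFrom (cube d) h er σ f (ask xs φ) ≟ false) + exposure h er xs
    ask-rejects h er []       φ eq = subst (_≤ indicator (φ [] ≟ false) + 0ℚ) (+-identityʳ 1ℚ)
      (+-monoˡ-≤ 0ℚ (1≤indicator (φ [] ≟ false) eq))
    ask-rejects h er (x ∷ xs) φ eq with x ∈? er
      where open import Data.List.Membership.DecPropositional (FiniteSet._≟_ (cube d)) using (_∈?_)
    -- From here the actual run follows `h⊥` and the exposure follows the truthful `h′`. They need
    -- not be related any more, since `hits er x` pays for this outcome.
    ... | yes x∈er =
      +-mono-≤ {0ℚ} {indicator (b ≟ false)} {1ℚ} {hits er x + exposure h′ er′ xs} (0≤indicator (b ≟ false))
        (+-mono-≤ {1ℚ} {hits er x} {0ℚ} {exposure h′ er′ xs} (∈⇒1≤hits x∈er) (0≤exposure h′ er′ xs))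
      where
      h⊥ = (x , nothing) ∷ h
      b = runFrom (cube d) h⊥ (Vec≤.toList (σ h⊥) List.++ er) σ f (ask xs (λ _ → true))
      h′ = (x , just (f x)) ∷ h
      er′ = Vec≤.toList (σ h′) List.++ er
    ... | no _ = ≤-trans (ask-rejects h′ er′ xs (λ ys → φ (f x ∷ ys)) eq)
      (+-monoʳ-≤ (indicator (runFrom (cube d) h′ er′ σ f (ask xs (λ ys → φ (f x ∷ ys))) ≟ false))
        (subst (_≤ hits er x + exposure h′ er′ xs) (+-identityˡ (exposure h′ er′ xs))
          (+-monoˡ-≤ (exposure h′ er′ xs) (0≤hits er x))))
      where
      h′ = (x , just (f x)) ∷ h
      er′ = Vec≤.toList (σ h′) List.++ er

    history : ∀ {m} → Transcript V Bool → Vec V m → Transcript V Bool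
    history h []       = h
    history h (x ∷ xs) = history ((x , just (f x)) ∷ h) xs

    erasedAfter : ∀ {m} → Transcript V Bool → List V → Vec V m → List V
    erasedAfter h er []       = er
    erasedAfter h er (x ∷ xs) = erasedAfter h′ (Vec≤.toList (σ h′) List.++ er) xs
      where h′ = (x , just (f x)) ∷ h

    -- Separates the reserve, whose points are independent and uniform, from the last three points,
    -- which depend on it.
    exposure-++ : ∀ {m k} h er (xs : Vec V m) (ys : Vec V k) → exposure h er (xs ++ ys) ≡
                  exposure h er xs + exposure (history h xs) (erasedAfter h er xs) ys
    exposure-++ h er []       ys = sym (+-identityˡ (exposure h er ys))
    exposure-++ h er (x ∷ xs) ys = trans
      (cong (hits er x +_) (exposure-++ _ _ xs ys))
      (sym (+-assoc (hits er x) (exposure _ _ xs) (exposure _ _ ys)))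

    length-erasures : ∀ h er →
      fromℕ (length (Vec≤.toList (σ h) List.++ er)) ≤ fromℕ t + fromℕ (length er)
    length-erasures h er = begin
      fromℕ (length (Vec≤.toList (σ h) List.++ er))         ≡⟨ cong fromℕ (length-++ (Vec≤.toList (σ h))) ⟩
      fromℕ (length (Vec≤.toList (σ h)) ℕ.+ length er)
        ≤⟨ fromℕ-mono {length (Vec≤.toList (σ h)) ℕ.+ length er} {t ℕ.+ length er}
             (ℕ.+-monoˡ-≤ (length er) (length-toList≤ (σ h))) ⟩
      fromℕ (t ℕ.+ length er)                               ≡⟨ fromℕ-+ t (length er) ⟩
      fromℕ t + fromℕ (length er)                           ∎
      where open ≤-Reasoning

    length-erasedAfter : ∀ {m} h er (xs : Vec V m) →
      fromℕ (length (erasedAfter h er xs)) ≤ fromℕ (length er) + fromℕ m * fromℕ t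
    length-erasedAfter h er [] = ≤-reflexive (lemma (fromℕ (length er)) (fromℕ t))
      where
      lemma : ∀ a b → a ≡ a + 0ℚ * b
      lemma = solve-∀ ring
    length-erasedAfter {suc m} h er (x ∷ xs) = begin
      fromℕ (length (erasedAfter h er (x ∷ xs)))
        ≤⟨ length-erasedAfter h′ _ xs ⟩
      fromℕ (length (Vec≤.toList (σ h′) List.++ er)) + fromℕ m * fromℕ t
        ≤⟨ +-monoˡ-≤ (fromℕ m * fromℕ t) (length-erasures h′ er) ⟩
      fromℕ t + fromℕ (length er) + fromℕ m * fromℕ t
        ≡⟨ lemma (fromℕ t) (fromℕ (length er)) (fromℕ m) ⟩
      fromℕ (length er) + (1ℚ + fromℕ m) * fromℕ t
        ≡⟨ cong (λ ◌ → fromℕ (length er) + ◌ * fromℕ t) (fromℕ-suc m) ⟨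
      fromℕ (length er) + fromℕ (suc m) * fromℕ t ∎
      where
      open ≤-Reasoning
      h′ = (x , just (f x)) ∷ h
      lemma : ∀ a b c → a + b + c * a ≡ b + (1ℚ + c) * a
      lemma = solve-∀ ring

    -- Each point is uniform and `er` is determined before it, so it is hit with mean |er| / 2^d;
    -- afterwards the list has grown by at most t. The induction therefore runs over all transcripts
    -- and all lists.
    𝔼-exposure : ∀ n h er → (𝔼[ z ∈ vectors (cube d) n ] exposure h er z) ≤
                 fromℕ n * (fromℕ (length er) + fromℕ n * fromℕ t) * ½ ^ d
    𝔼-exposure zero h er = ≤-reflexive (trans (𝔼-[] (cube d) (exposure h er))
      (lemma (fromℕ (length er) + 0ℚ * fromℕ t) (½ ^ d)))
      where
      lemma : ∀ a b → 0ℚ ≡ 0ℚ * a * b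
      lemma = solve-∀ ring
    𝔼-exposure (suc n) h er = begin
      (𝔼[ z ∈ vectors (cube d) (suc n) ] exposure h er z)
        ≡⟨ 𝔼-∷ (cube d) n (exposure h er) ⟩
      (𝔼[ x ∈ cube d ] 𝔼[ z ∈ Z ] hits er x + exposure (h′ x) (er′ x) z)
        ≡⟨ 𝔼-cong (cube d) (λ x → trans (𝔼-+ Z (λ _ → hits er x) (exposure (h′ x) (er′ x)))
             (cong (_+ 𝔼 Z (exposure (h′ x) (er′ x))) (𝔼-const Z (hits er x)))) ⟩
      (𝔼[ x ∈ cube d ] hits er x + 𝔼 Z (exposure (h′ x) (er′ x)))
        ≡⟨ 𝔼-+ (cube d) (hits er) (λ x → 𝔼 Z (exposure (h′ x) (er′ x))) ⟩
      𝔼 (cube d) (hits er) + (𝔼[ x ∈ cube d ] 𝔼 Z (exposure (h′ x) (er′ x)))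
        ≤⟨ +-mono-≤ (≤-reflexive (𝔼-hits er)) (𝔼-≤ (cube d) rest) ⟩
      e * D + ν * (τ + e + ν * τ) * D
        -- The stated bound is slightly loose so as to have a simple closed form; the surplus is (1
        -- + ν) τ D.
        ≤⟨ 0≤-⇒≤ (subst (0ℚ ≤_) (slack e ν τ D) (0≤* (0≤* (0≤+ (nonNegative⁻¹ 1ℚ) (0≤fromℕ n)) (0≤fromℕ t)) (0≤½^ d))) ⟩
      (1ℚ + ν) * (e + (1ℚ + ν) * τ) * D
        ≡⟨ cong (λ ◌ → ◌ * (e + ◌ * τ) * D) (fromℕ-suc n) ⟨
      fromℕ (suc n) * (e + fromℕ (suc n) * τ) * D ∎
      where
      open ≤-Reasoning
      Z = vectors (cube d) n
      D = ½ ^ d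
      e = fromℕ (length er)
      ν = fromℕ n
      τ = fromℕ t
      h′ : V → Transcript V Bool
      h′ x = (x , just (f x)) ∷ h
      er′ : V → List V
      er′ x = Vec≤.toList (σ (h′ x)) List.++ er
      rest : ∀ x → 𝔼 Z (exposure (h′ x) (er′ x)) ≤ ν * (τ + e + ν * τ) * D
      rest x = ≤-trans (𝔼-exposure n (h′ x) (er′ x))
        (*-monoʳ (0≤½^ d) (*-monoˡ (0≤fromℕ n) (+-monoˡ-≤ (ν * τ) (length-erasures (h′ x) er))))
      slack : ∀ e ν τ D → (1ℚ + ν) * τ * D ≡
              (1ℚ + ν) * (e + (1ℚ + ν) * τ) * D - (e * D + ν * (τ + e + ν * τ) * D)
      slack = solve-∀ ring

-- The tester

verdict : ∀ {n} → Vec Bool n → Vec Bool n → Vec Bool n → Vec Bool 3 → Bool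
verdict I J ys (a ∷ b ∷ c ∷ []) = not (((a xor b) xor ⊕[ I ] ys) ∨ ((a xor c) xor ⊕[ J ] ys))

decision : ∀ {n} → Vec Bool n → Vec Bool n → Vec Bool (n ℕ.+ 3) → Bool
decision {n} I J answers = verdict I J (Vec.take n answers) (Vec.drop n answers)

-- The reserve is asked first: the erasures made during it are determined by z, and each of the last
-- three points, being a translate of x by a vector that depends on z, I and J only, is uniform
-- against them.
queries : ∀ {n d} → Vec (Vec Bool d) n → Vec Bool n → Vec Bool n → Vec Bool d → Vec (Vec Bool d) (n ℕ.+ 3)
queries z I J x = z ++ x ∷ x ⊕ I ∙ z ∷ x ⊕ J ∙ z ∷ []

-- Named for the last three queries, which lie in a common coset of the span of the reserve.
coset-tester : ∀ d → ℕ → Algorithm (cube d) Bool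
coset-tester d n = record
  { Coins = vectors (cube d) n ⊗ cube n ⊗ cube n ⊗ cube d
  ; tree  = λ (z , I , J , x) → ask (queries z I J x) (decision I J)
  }

decision-honest : ∀ {n d} (f : Vec Bool d → Bool) (z : Vec (Vec Bool d) n) I J x →
  decision I J (Vec.map f (queries z I J x)) ≡ not (violation f z x I ∨ violation f z x J)
decision-honest {n} f z I J x = cong₂ (verdict I J) (proj₁ parts) (proj₂ parts)
  where
  answers = Vec.map f (queries z I J x)
  parts = ++-injective (Vec.take n answers) (Vec.map f z)
    (trans (take++drop≡id n answers) (map-++ f z (x ∷ x ⊕ I ∙ z ∷ x ⊕ J ∙ z ∷ [])))

⊕[]-∙ : ∀ {n d} (S : Vec Bool d) I (z : Vec (Vec Bool d) n) → ⊕[ S ] (I ∙ z) ≡ ⊕[ I ] (Vec.map (⊕[ S ]) z)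
⊕[]-∙ S []          []      = ⊕[]-0 S
  where
  ⊕[]-0 : ∀ {d} (S : Vec Bool d) → ⊕[ S ] (Vec.replicate d false) ≡ false
  ⊕[]-0 []      = refl
  ⊕[]-0 (b ∷ S) = cong₂ _xor_ (𝔹.∧-zeroʳ b) (⊕[]-0 S)
⊕[]-∙ S (false ∷ I) (x ∷ z) = ⊕[]-∙ S I z
⊕[]-∙ S (true  ∷ I) (x ∷ z) = trans (⊕[]-⊕ S x (I ∙ z)) (cong (⊕[ S ] x xor_) (⊕[]-∙ S I z))

linear⇒no-violation : ∀ {n d} (f : Vec Bool d → Bool) → Linear d f → ∀ (z : Vec (Vec Bool d) n) x I →
                      violation f z x I ≡ false
linear⇒no-violation f (S , f≗S) z x I = begin
  (f x xor f (x ⊕ I ∙ z)) xor ⊕[ I ] (Vec.map f z)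
    ≡⟨ cong₂ _xor_ (cong₂ _xor_ (f≗S x) (trans (f≗S (x ⊕ I ∙ z)) (⊕[]-⊕ S x (I ∙ z))))
         (trans (cong (⊕[ I ]) (map-cong f≗S z)) (sym (⊕[]-∙ S I z))) ⟩
  (⊕[ S ] x xor (⊕[ S ] x xor ⊕[ S ] (I ∙ z))) xor ⊕[ S ] (I ∙ z)
    ≡⟨ cancel (⊕[ S ] x) (⊕[ S ] (I ∙ z)) ⟩
  false ∎
  where
  open ≡-Reasoning
  cancel : ∀ a b → (a xor (a xor b)) xor b ≡ false
  cancel false false = refl
  cancel false true  = refl
  cancel true  false = refl
  cancel true  true  = refl

one-sided : ∀ d n {t} → OneSidedError t (Linear d) (coset-tester d n)
one-sided d n f σ linear = begin
  Pr[ coset-tester d n outputs true ∣ σ , f ]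
    ≡⟨ fraction≡𝔼 Ω (λ ω → run (cube d) σ f (tree ω) ≟ true) ⟩
  (𝔼[ ω ∈ Ω ] indicator (run (cube d) σ f (tree ω) ≟ true))
    ≡⟨ 𝔼-cong Ω (λ (z , I , J , x) → cong (λ b → indicator (b ≟ true))
         (ask-accepts f σ [] [] (queries z I J x) (decision I J) (trans (decision-honest f z I J x)
         (cong₂ (λ a b → not (a ∨ b)) (linear⇒no-violation f linear z x I) (linear⇒no-violation f linear z x J))))) ⟩
  (𝔼[ ω ∈ Ω ] 1ℚ)
    ≡⟨ 𝔼-const Ω 1ℚ ⟩
  1ℚ ∎
  where
  open ≡-Reasoning
  open Algorithm (coset-tester d n) renaming (Coins to Ω)

1≤no-violation : ∀ a b → a ∨ b ≡ false → 1ℚ ≤ no-violation a b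
1≤no-violation false false _ = ≤-refl

0≤no-violation : ∀ a b → 0ℚ ≤ no-violation a b
0≤no-violation false false = nonNegative⁻¹ 1ℚ
0≤no-violation false true  = ≤-refl
0≤no-violation true  false = ≤-refl
0≤no-violation true  true  = ≤-refl

union-bound : ∀ Ω (g h k : Carrier Ω → ℚ) {p q} → (∀ ω → 1ℚ ≤ g ω + (h ω + k ω)) →
              𝔼 Ω h ≤ p → 𝔼 Ω k ≤ q → 1ℚ - (p + q) ≤ 𝔼 Ω g
union-bound Ω g h k {p} {q} 1≤ h≤p k≤q =
  0≤-⇒≤ (subst (0ℚ ≤_) (rearrange (𝔼 Ω g) p q) (≤⇒0≤- total))
  where
  open ≤-Reasoning
  rearrange : ∀ a b c → a + (b + c) - 1ℚ ≡ a - (1ℚ - (b + c))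
  rearrange = solve-∀ ring
  total : 1ℚ ≤ 𝔼 Ω g + (p + q)
  total = begin
    1ℚ                                ≡⟨ 𝔼-const Ω 1ℚ ⟨
    (𝔼[ ω ∈ Ω ] 1ℚ)                   ≤⟨ 𝔼-mono Ω 1≤ ⟩
    (𝔼[ ω ∈ Ω ] g ω + (h ω + k ω))    ≡⟨ trans (𝔼-+ Ω g (λ ω → h ω + k ω)) (cong (𝔼 Ω g +_) (𝔼-+ Ω h k)) ⟩
    𝔼 Ω g + (𝔼 Ω h + 𝔼 Ω k)           ≤⟨ +-monoʳ-≤ (𝔼 Ω g) (+-mono-≤ h≤p k≤q) ⟩
    𝔼 Ω g + (p + q)                   ∎

𝔼-+-≤ : ∀ Ω (g h : Carrier Ω → ℚ) {p q} → 𝔼 Ω g ≤ p → 𝔼 Ω h ≤ q → (𝔼[ ω ∈ Ω ] g ω + h ω) ≤ p + q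
𝔼-+-≤ Ω g h {p} {q} g≤p h≤q = subst (_≤ p + q) (sym (𝔼-+ Ω g h)) (+-mono-≤ g≤p h≤q)

module _ {d n t : ℕ} (f : Vec Bool d → Bool) (σ : Strategy t (Vec Bool d) Bool) where

  private
    Z = vectors (cube d) n
    open Algorithm (coset-tester d n) using (tree) renaming (Coins to Ω)

    𝔼-Ω : ∀ (g : Vec (Vec Bool d) n → Vec Bool n → Vec Bool n → Vec Bool d → ℚ) →
      (𝔼[ (z , I , J , x) ∈ Ω ] g z I J x) ≡
      (𝔼[ z ∈ Z ] 𝔼[ I ∈ cube n ] 𝔼[ J ∈ cube n ] 𝔼[ x ∈ cube d ] g z I J x)
    𝔼-Ω g = trans (𝔼-⊗ Z (cube n ⊗ cube n ⊗ cube d) (λ (z , I , J , x) → g z I J x))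
      (𝔼-cong Z (λ z → trans (𝔼-⊗ (cube n) (cube n ⊗ cube d) (λ (I , J , x) → g z I J x))
      (𝔼-cong (cube n) (λ I → 𝔼-⊗ (cube n) (cube d) (λ (J , x) → g z I J x)))))

  -- The first summand is for the reserve. The second is for each of the last three points meeting
  -- an erasure made before x was asked. The third is for three guesses: the erasures after x
  -- against I and against J, and those after x ⊕ I ∙ z against J. The 0ℚ is the length of the
  -- initial, empty list of erasures.
  𝔼-exposure-queries : (𝔼[ (z , I , J , x) ∈ Ω ] exposure f σ [] [] (queries z I J x)) ≤
    fromℕ n * (0ℚ + fromℕ n * fromℕ t) * ½ ^ d +
    (fromℕ 3 * ((0ℚ + fromℕ n * fromℕ t) * ½ ^ d) +
     fromℕ 3 * (ℤ.+ 1 / 100 + fromℕ 100 * (fromℕ t * fromℕ t) * (½ ^ n + ½ ^ d)))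
  𝔼-exposure-queries = begin
    (𝔼[ (z , I , J , x) ∈ Ω ] exposure f σ [] [] (queries z I J x))
      ≡⟨ 𝔼-cong Ω (λ (z , I , J , x) → split z I J x) ⟩
    (𝔼[ ω ∈ Ω ] A ω + ((B₀ ω + (B₁ ω + B₂ ω)) + (C₁ ω + (C₂ ω + C₃ ω))))
      ≤⟨ 𝔼-+-≤ Ω A (λ ω → (B₀ ω + (B₁ ω + B₂ ω)) + (C₁ ω + (C₂ ω + C₃ ω))) {α} {(β + (β + β)) + (γ + (γ + γ))} 𝔼A≤
         (𝔼-+-≤ Ω (λ ω → B₀ ω + (B₁ ω + B₂ ω)) (λ ω → C₁ ω + (C₂ ω + C₃ ω)) {β + (β + β)} {γ + (γ + γ)}
         (𝔼-+-≤ Ω B₀ (λ ω → B₁ ω + B₂ ω) {β} {β + β} 𝔼B₀≤ (𝔼-+-≤ Ω B₁ B₂ {β} {β} 𝔼B₁≤ 𝔼B₂≤))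
         (𝔼-+-≤ Ω C₁ (λ ω → C₂ ω + C₃ ω) {γ} {γ + γ} 𝔼C₁≤ (𝔼-+-≤ Ω C₂ C₃ {γ} {γ} 𝔼C₂≤ 𝔼C₃≤))) ⟩
    α + ((β + (β + β)) + (γ + (γ + γ)))
      ≡⟨ cong (α +_) (cong₂ _+_ (triple β) (triple γ)) ⟩
    α + (fromℕ 3 * β + fromℕ 3 * γ) ∎
    where
    open ≤-Reasoning
    α = fromℕ n * (0ℚ + fromℕ n * fromℕ t) * ½ ^ d
    β = (0ℚ + fromℕ n * fromℕ t) * ½ ^ d
    γ = ℤ.+ 1 / 100 + fromℕ 100 * (fromℕ t * fromℕ t) * (½ ^ n + ½ ^ d)
    triple : ∀ a → a + (a + a) ≡ fromℕ 3 * a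
    triple = solve-∀ ring
    E : Vec (Vec Bool d) n → List (Vec Bool d)
    E z = erasedAfter f σ [] [] z
    h₁ : Vec (Vec Bool d) n → Vec Bool d → Transcript (Vec Bool d) Bool
    h₁ z x = (x , just (f x)) ∷ history f σ [] z
    h₂ : Vec (Vec Bool d) n → Vec Bool n → Vec Bool d → Transcript (Vec Bool d) Bool
    h₂ z I x = (x ⊕ I ∙ z , just (f (x ⊕ I ∙ z))) ∷ h₁ z x
    T₁ : Vec (Vec Bool d) n → Vec Bool d → List (Vec Bool d)
    T₁ z x = Vec≤.toList (σ (h₁ z x))
    T₂ : Vec (Vec Bool d) n → Vec Bool n → Vec Bool d → List (Vec Bool d)
    T₂ z I x = Vec≤.toList (σ (h₂ z I x))
    A B₀ B₁ B₂ C₁ C₂ C₃ : Carrier Ω → ℚ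
    A  (z , I , J , x) = exposure f σ [] [] z
    B₀ (z , I , J , x) = hits (E z) x
    B₁ (z , I , J , x) = hits (E z) (x ⊕ I ∙ z)
    B₂ (z , I , J , x) = hits (E z) (x ⊕ J ∙ z)
    C₁ (z , I , J , x) = hits (T₁ z x) (x ⊕ I ∙ z)
    C₂ (z , I , J , x) = hits (T₁ z x) (x ⊕ J ∙ z)
    C₃ (z , I , J , x) = hits (T₂ z I x) (x ⊕ J ∙ z)
    split : ∀ z I J x → let ω = (z , I , J , x) in exposure f σ [] [] (queries z I J x) ≡
            A ω + ((B₀ ω + (B₁ ω + B₂ ω)) + (C₁ ω + (C₂ ω + C₃ ω)))
    split z I J x = trans (exposure-++ f σ [] [] z (x ∷ x ⊕ I ∙ z ∷ x ⊕ J ∙ z ∷ []))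
      (cong (A ω +_) (trans
        (cong (B₀ ω +_) (cong₂ (λ p q → p + (q + 0ℚ))
          (∑-++ (T₁ z x) (E z) (λ e → δ (e ⊕ (x ⊕ I ∙ z))))
          (trans (∑-++ (T₂ z I x) (T₁ z x List.++ E z) (λ e → δ (e ⊕ (x ⊕ J ∙ z))))
            (cong (C₃ ω +_) (∑-++ (T₁ z x) (E z) (λ e → δ (e ⊕ (x ⊕ J ∙ z))))))))
        (rearrange (B₀ ω) (C₁ ω) (B₁ ω) (C₃ ω) (C₂ ω) (B₂ ω))))
      where
      ω = (z , I , J , x)
      rearrange : ∀ b₀ c₁ b₁ c₃ c₂ b₂ → b₀ + ((c₁ + b₁) + ((c₃ + (c₂ + b₂)) + 0ℚ)) ≡
                  (b₀ + (b₁ + b₂)) + (c₁ + (c₂ + c₃))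
      rearrange = solve-∀ ring
    𝔼A≤ : 𝔼 Ω A ≤ fromℕ n * (0ℚ + fromℕ n * fromℕ t) * ½ ^ d
    𝔼A≤ = begin
      𝔼 Ω A
        ≡⟨ 𝔼-Ω (λ z I J x → exposure f σ [] [] z) ⟩
      (𝔼[ z ∈ Z ] 𝔼[ I ∈ cube n ] 𝔼[ J ∈ cube n ] 𝔼[ x ∈ cube d ] exposure f σ [] [] z)
        ≤⟨ 𝔼-mono Z (λ z → 𝔼-≤ (cube n) (λ I → 𝔼-≤ (cube n) (λ J → 𝔼-≤ (cube d) (λ x → ≤-refl)))) ⟩
      (𝔼[ z ∈ Z ] exposure f σ [] [] z)
        ≤⟨ 𝔼-exposure f σ n [] [] ⟩
      fromℕ n * (0ℚ + fromℕ n * fromℕ t) * ½ ^ d ∎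
    𝔼-hits-E : ∀ z → 𝔼 (cube d) (hits (E z)) ≤ β
    𝔼-hits-E z = subst (_≤ β) (sym (𝔼-hits (E z)))
      (*-monoʳ (0≤½^ d) (length-erasedAfter f σ [] [] z))
    𝔼B≤ : ∀ (u : Vec (Vec Bool d) n → Vec Bool n → Vec Bool n → Vec Bool d) →
      (𝔼[ (z , I , J , x) ∈ Ω ] hits (E z) (x ⊕ u z I J)) ≤ β
    𝔼B≤ u = ≤-trans (≤-reflexive (𝔼-Ω (λ z I J x → hits (E z) (x ⊕ u z I J))))
      (𝔼-≤ Z (λ z → 𝔼-≤ (cube n) (λ I → 𝔼-≤ (cube n) (λ J →
        ≤-trans (≤-reflexive (𝔼-shift (u z I J) (hits (E z)))) (𝔼-hits-E z)))))
    𝔼B₀≤ : 𝔼 Ω B₀ ≤ β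
    𝔼B₀≤ = ≤-trans (≤-reflexive (𝔼-Ω (λ z I J x → hits (E z) x)))
      (𝔼-≤ Z (λ z → 𝔼-≤ (cube n) (λ I → 𝔼-≤ (cube n) (λ J → 𝔼-hits-E z))))
    𝔼B₁≤ : 𝔼 Ω B₁ ≤ β
    𝔼B₁≤ = 𝔼B≤ (λ z I J → I ∙ z)
    𝔼B₂≤ : 𝔼 Ω B₂ ≤ β
    𝔼B₂≤ = 𝔼B≤ (λ z I J → J ∙ z)
    κ : Vec (Vec Bool d) n → ℚ
    κ z = ℤ.+ 1 / 100 + fromℕ 100 * (fromℕ t * fromℕ t) * collision z
    𝔼κ≤ : 𝔼 Z κ ≤ γ
    𝔼κ≤ = begin
      𝔼 Z κ
        ≡⟨ 𝔼-+ Z (λ _ → ℤ.+ 1 / 100) (λ z → c * collision z) ⟩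
      (𝔼[ z ∈ Z ] ℤ.+ 1 / 100) + (𝔼[ z ∈ Z ] c * collision z)
        ≡⟨ cong₂ _+_ (𝔼-const Z (ℤ.+ 1 / 100)) (𝔼-*ˡ Z c collision) ⟩
      ℤ.+ 1 / 100 + c * 𝔼 Z collision
        ≤⟨ +-monoʳ-≤ (ℤ.+ 1 / 100) (*-monoˡ (0≤* (0≤fromℕ 100) (0≤* (0≤fromℕ t) (0≤fromℕ t))) (𝔼-collision n d)) ⟩
      γ ∎
      where c = fromℕ 100 * (fromℕ t * fromℕ t)
    guess : ∀ (T : Vec (Vec Bool d) n → Vec Bool n → Vec Bool d → List (Vec Bool d)) →
      (∀ z I x → length (T z I x) ℕ.≤ t) → ∀ z I →
      (𝔼[ J ∈ cube n ] 𝔼[ x ∈ cube d ] hits (T z I x) (x ⊕ J ∙ z)) ≤ κ z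
    -- J is averaged innermost, as T is chosen with knowledge of z, I and x only.
    guess T |T|≤t z I = ≤-trans
      (≤-reflexive (𝔼-swap (cube n) (cube d) (λ J x → hits (T z I x) (x ⊕ J ∙ z))))
      (𝔼-≤ (cube d) (λ x → 𝔼-hits-guess z (T z I x) x (|T|≤t z I x)))
    𝔼C≤ : ∀ (T : Vec (Vec Bool d) n → Vec Bool n → Vec Bool d → List (Vec Bool d)) →
      (∀ z I x → length (T z I x) ℕ.≤ t) →
      (𝔼[ (z , I , J , x) ∈ Ω ] hits (T z I x) (x ⊕ J ∙ z)) ≤ γ
    𝔼C≤ T |T|≤t = ≤-trans (≤-reflexive (𝔼-Ω (λ z I J x → hits (T z I x) (x ⊕ J ∙ z))))
      (≤-trans (𝔼-mono Z (λ z → 𝔼-≤ (cube n) (guess T |T|≤t z))) 𝔼κ≤)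
    𝔼C₁≤ : 𝔼 Ω C₁ ≤ γ
    𝔼C₁≤ = begin
      𝔼 Ω C₁
        ≡⟨ 𝔼-Ω (λ z I J x → hits (T₁ z x) (x ⊕ I ∙ z)) ⟩
      (𝔼[ z ∈ Z ] 𝔼[ I ∈ cube n ] 𝔼[ J ∈ cube n ] 𝔼[ x ∈ cube d ] hits (T₁ z x) (x ⊕ I ∙ z))
        -- Here I is the hidden subset; the swap lets it take the place of J in `guess`.
        ≡⟨ 𝔼-cong Z (λ z → 𝔼-swap (cube n) (cube n) (λ I J → 𝔼[ x ∈ cube d ] hits (T₁ z x) (x ⊕ I ∙ z))) ⟩
      (𝔼[ z ∈ Z ] 𝔼[ J ∈ cube n ] 𝔼[ I ∈ cube n ] 𝔼[ x ∈ cube d ] hits (T₁ z x) (x ⊕ I ∙ z))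
        ≤⟨ 𝔼-mono Z (λ z → 𝔼-≤ (cube n)
             (guess (λ z _ x → T₁ z x) (λ z I x → length-toList≤ (σ (h₁ z x))) z)) ⟩
      𝔼 Z κ
        ≤⟨ 𝔼κ≤ ⟩
      γ ∎
    𝔼C₂≤ : 𝔼 Ω C₂ ≤ γ
    𝔼C₂≤ = 𝔼C≤ (λ z _ x → T₁ z x) (λ z I x → length-toList≤ (σ (h₁ z x)))
    𝔼C₃≤ : 𝔼 Ω C₃ ≤ γ
    𝔼C₃≤ = 𝔼C≤ T₂ (λ z I x → length-toList≤ (σ (h₂ z I x)))

  -- For every outcome of the coins the tester rejects, or both checks hold on the true values, or
  -- the exposure is at least 1.
  rejects≥ : ∀ {p q} →
    (𝔼[ z ∈ Z ] 𝔼[ I ∈ cube n ] 𝔼[ J ∈ cube n ] 𝔼[ x ∈ cube d ] passes f z x I J) ≤ p →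
    (𝔼[ (z , I , J , x) ∈ Ω ] exposure f σ [] [] (queries z I J x)) ≤ q →
    1ℚ - (p + q) ≤ Pr[ coset-tester d n outputs false ∣ σ , f ]
  rejects≥ {p} {q} 𝔼P≤ 𝔼X≤ = subst (1ℚ - (p + q) ≤_)
    (sym (fraction≡𝔼 Ω (λ ω → run (cube d) σ f (tree ω) ≟ false)))
    (union-bound Ω N P X pointwise
      (subst (_≤ p) (sym (𝔼-Ω (λ z I J x → passes f z x I J))) 𝔼P≤) 𝔼X≤)
    where
    N P X : Carrier Ω → ℚ
    N ω = indicator (run (cube d) σ f (tree ω) ≟ false)
    P (z , I , J , x) = passes f z x I J
    X (z , I , J , x) = exposure f σ [] [] (queries z I J x)
    pointwise : ∀ ω → 1ℚ ≤ N ω + (P ω + X ω)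
    pointwise ω@(z , I , J , x) = by-verdict (violation f z x I ∨ violation f z x J) refl
      where
      by-verdict : ∀ b → violation f z x I ∨ violation f z x J ≡ b → 1ℚ ≤ N ω + (P ω + X ω)
      by-verdict false eq = +-mono-≤ {0ℚ} {N ω} {1ℚ} {P ω + X ω}
        (0≤indicator (run (cube d) σ f (tree ω) ≟ false))
        (+-mono-≤ {1ℚ} {P ω} {0ℚ} {X ω} (1≤no-violation (violation f z x I) (violation f z x J) eq)
          (0≤exposure f σ [] [] (queries z I J x)))
      by-verdict true eq = ≤-trans {1ℚ} {N ω + X ω} {N ω + (P ω + X ω)}
        (ask-rejects f σ [] [] (queries z I J x) (decision I J) (trans (decision-honest f z I J x) (cong not eq)))
        (+-monoʳ-≤ (N ω) (subst (_≤ P ω + X ω) (+-identityˡ (X ω))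
          (+-monoˡ-≤ (X ω) (0≤no-violation (violation f z x I) (violation f z x J)))))

-- The size of the reserve

-- The least k with t ≤ 2 ^ k, that is, the logarithm rounded up, with value 0 at t = 0.
lg : ℕ → ℕ
lg zero = 0
lg (suc t) with suc t ℕ.≤? 2 ℕ.^ lg t
... | yes _ = lg t
... | no  _ = suc (lg t)

n≤2^lg : ∀ t → t ℕ.≤ 2 ℕ.^ lg t
n≤2^lg zero = ℕ.z≤n
n≤2^lg (suc t) with suc t ℕ.≤? 2 ℕ.^ lg t
... | yes le = le
... | no  _  = begin
  1 ℕ.+ t                                    ≤⟨ ℕ.+-mono-≤ (ℕ.m^n>0 2 (lg t)) (n≤2^lg t) ⟩
  2 ℕ.^ lg t ℕ.+ 2 ℕ.^ lg t                  ≡⟨ cong (2 ℕ.^ lg t ℕ.+_) (ℕ.+-identityʳ (2 ℕ.^ lg t)) ⟨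
  2 ℕ.* 2 ℕ.^ lg t                           ∎
  where open ℕ.≤-Reasoning

2^lg≤2n : ∀ t → 2 ℕ.^ lg (suc t) ℕ.≤ 2 ℕ.* suc t
2^lg≤2n t with suc t ℕ.≤? 2 ℕ.^ lg t
2^lg≤2n t       | no  nle = ℕ.*-monoʳ-≤ 2 (ℕ.<⇒≤ (ℕ.≰⇒> nle))
2^lg≤2n zero    | yes _   = ℕ.s≤s ℕ.z≤n
2^lg≤2n (suc t) | yes _   = ℕ.≤-trans (2^lg≤2n t) (ℕ.*-monoʳ-≤ 2 (ℕ.n≤1+n (suc t)))

lg≤n : ∀ t → lg t ℕ.≤ t
lg≤n zero = ℕ.z≤n
lg≤n (suc t) with suc t ℕ.≤? 2 ℕ.^ lg t
... | yes _ = ℕ.m≤n⇒m≤1+n (lg≤n t)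
... | no  _ = ℕ.s≤s (lg≤n t)

-- The value at m = 0 is irrelevant.
1+⌊_/_⌋ : ℕ → ℕ → ℕ
1+⌊ n / zero  ⌋ = 0
1+⌊ n / suc m ⌋ = suc (n ℕ./ suc m)

-- The number 17 comes from Bernoulli's inequality: n ε ≥ 17 gives (1 - ε)ⁿ ≤ 1/(1 + 17). The
-- rounding of 1/ε is strictly upwards, so n ≥ 17 + 2 lg t as well.
reserve : ℕ → ℚ → ℕ
reserve t ε = 17 ℕ.* 1+⌊ ↧ₙ ε / ℤ.∣ ↥ ε ∣ ⌋ ℕ.+ 2 ℕ.* lg t

fromℕ-^ : ∀ m k → fromℕ (m ℕ.^ k) ≡ fromℕ m ^ k
fromℕ-^ m zero    = refl
fromℕ-^ m (suc k) = trans (fromℕ-* m (m ℕ.^ k)) (cong (fromℕ m *_) (fromℕ-^ m k))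

1≤^ : ∀ {p} n → 1ℚ ≤ p → 1ℚ ≤ p ^ n
1≤^ {p} n 1≤p = subst (_≤ p ^ n) (1^ n) (^-monoˡ n (nonNegative⁻¹ 1ℚ) 1≤p)

2*½^ : ∀ k → fromℕ 2 ^ k * ½ ^ k ≡ 1ℚ
2*½^ k = trans (sym (^-distrib-* (fromℕ 2) ½ k)) (1^ k)

≤-by-dec : ∀ {p q} → {_ : True (p ℚ.≤? q)} → p ≤ q
≤-by-dec {_} {_} {le} = toWitness le

-- Bounds (1 - ε)ⁿ by 1/(1 + n ε) without exponentials or division. The induction step is (1 - ε)(1
-- + (n + 1) ε) = 1 + n ε - (n + 1) ε².
bernoulli : ∀ n {ε} → 0ℚ ≤ ε → ε ≤ 1ℚ → (1ℚ - ε) ^ n * (1ℚ + fromℕ n * ε) ≤ 1ℚ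
bernoulli zero    {ε} _   _   = ≤-reflexive (lemma ε)
  where
  lemma : ∀ a → 1ℚ * (1ℚ + 0ℚ * a) ≡ 1ℚ
  lemma = solve-∀ ring
bernoulli (suc n) {ε} 0≤ε ε≤1 = begin
  (1ℚ - ε) * (1ℚ - ε) ^ n * (1ℚ + fromℕ (suc n) * ε)
    ≡⟨ cong (λ ◌ → (1ℚ - ε) * (1ℚ - ε) ^ n * (1ℚ + ◌ * ε)) (fromℕ-suc n) ⟩
  (1ℚ - ε) * (1ℚ - ε) ^ n * (1ℚ + (1ℚ + fromℕ n) * ε)
    ≡⟨ expand ε ((1ℚ - ε) ^ n) (fromℕ n) ⟩
  (1ℚ - ε) ^ n * (1ℚ + fromℕ n * ε) - (1ℚ - ε) ^ n * ((1ℚ + fromℕ n) * (ε * ε))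
    ≤⟨ +-mono-≤ (bernoulli n 0≤ε ε≤1) (neg-antimono-≤
         (0≤* (0≤^ n (≤⇒0≤- ε≤1)) (0≤* (0≤+ (nonNegative⁻¹ 1ℚ) (0≤fromℕ n)) (0≤sq ε)))) ⟩
  1ℚ - 0ℚ ≡⟨⟩
  1ℚ ∎
  where
  open ≤-Reasoning
  expand : ∀ e p n → (1ℚ - e) * p * (1ℚ + (1ℚ + n) * e) ≡ p * (1ℚ + n * e) - p * ((1ℚ + n) * (e * e))
  expand = solve-∀ ring

denominator*ε : ∀ ε .{{_ : Positive ε}} → fromℕ (↧ₙ ε) * ε ≡ fromℕ ℤ.∣ ↥ ε ∣
denominator*ε ε@(mkℚ ℤ.+[1+ a ] b-1 _) = begin
  fromℕ b * ε                              ≡⟨ cong (fromℕ b *_) (trans (sym (↥p/↧p≡p ε)) (/≡*1/ (suc a) b)) ⟩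
  fromℕ b * (fromℕ (suc a) * (ℤ.+ 1 / b))  ≡⟨ lemma (fromℕ b) (fromℕ (suc a)) (ℤ.+ 1 / b) ⟩
  fromℕ b * (ℤ.+ 1 / b) * fromℕ (suc a)    ≡⟨ cong (_* fromℕ (suc a)) (1/-*-fromℕ b) ⟩
  1ℚ * fromℕ (suc a)                       ≡⟨ *-identityˡ (fromℕ (suc a)) ⟩
  fromℕ (suc a)                            ∎
  where
  open ≡-Reasoning
  b = suc b-1
  lemma : ∀ a b c → a * (b * c) ≡ a * c * b
  lemma = solve-∀ ring

numerator≢0 : ∀ ε .{{_ : Positive ε}} → ∃[ a ] ℤ.∣ ↥ ε ∣ ≡ suc a
numerator≢0 (mkℚ ℤ.+[1+ a ] _ _) = a , refl

numerator≤denominator : ∀ ε .{{_ : Positive ε}} → ε < 1ℚ → ℤ.∣ ↥ ε ∣ ℕ.≤ ↧ₙ ε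
numerator≤denominator (mkℚ ℤ.+[1+ a ] b-1 _) ε<1 = ℕ.<⇒≤ (ℤ.drop‿+<+
  (subst₂ ℤ._<_ (ℤ.*-identityʳ ℤ.+[1+ a ]) (ℤ.*-identityˡ ℤ.+[1+ b-1 ]) (drop-*<* ε<1)))

0<fromℕ-suc : ∀ n → Positive (fromℕ (suc n))
0<fromℕ-suc n = normalize-pos (suc n) 1

0<denominator : ∀ ε → Positive (fromℕ (↧ₙ ε))
0<denominator (mkℚ _ b-1 _) = 0<fromℕ-suc b-1

½^-antitone : ∀ {m n} → m ℕ.≤ n → ½ ^ n ≤ ½ ^ m
½^-antitone {n = n} ℕ.z≤n     = subst (½ ^ n ≤_) (1^ n) (^-monoˡ n (nonNegative⁻¹ ½) ≤-by-dec)
½^-antitone         (ℕ.s≤s le) = *-monoˡ {r = ½} (nonNegative⁻¹ ½) (½^-antitone le)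

≤1/18 : ∀ {p x} → 0ℚ ≤ p → fromℕ 17 ≤ x → p * (1ℚ + x) ≤ 1ℚ → p ≤ ℤ.+ 1 / 18
≤1/18 {p} {x} 0≤p 17≤x le = *-cancelʳ-≤-pos (1ℚ + fromℕ 17)
  (≤-trans (*-monoˡ 0≤p (+-monoʳ-≤ 1ℚ 17≤x)) le)

-- Its fourth power has to be small in two places: in `exposure-budget`, and below ¼ in
-- `accept-all-resilient`.
c₀ : ℚ
c₀ = ℤ.+ 1 / 100

module _ (t : ℕ) (ε : ℚ) .{{_ : Positive ε}} (ε<1 : ε < 1ℚ) where

  private
    a = ℤ.∣ ↥ ε ∣
    b = ↧ₙ ε
    r = 1+⌊ b / a ⌋
    L = lg t
    n = reserve t ε
    τ = fromℕ t
    ν = fromℕ n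
    0≤ε = <⇒≤ (positive⁻¹ ε)
    ε≤1 = <⇒≤ ε<1
    0<b = 0<denominator ε

  b≤a*r : b ℕ.≤ a ℕ.* r
  b≤a*r with a | numerator≢0 ε
  ... | _ | m , refl = begin
    b                                              ≡⟨ ℕ.m≡m%n+[m/n]*n b (suc m) ⟩
    b ℕ.% suc m ℕ.+ b ℕ./ suc m ℕ.* suc m          ≤⟨ ℕ.+-monoˡ-≤ (b ℕ./ suc m ℕ.* suc m) (ℕ.m%n≤n b (suc m)) ⟩
    suc (b ℕ./ suc m) ℕ.* suc m                    ≡⟨ ℕ.*-comm (suc (b ℕ./ suc m)) (suc m) ⟩
    suc m ℕ.* suc (b ℕ./ suc m)                    ∎
    where open ℕ.≤-Reasoning

  -- Rounding up adds at most a, and a ≤ b because ε < 1. In terms of ε = a/b this is r ε ≤ 2, the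
  -- counterpart of 1 ≤ r ε.
  a*r≤2b : a ℕ.* r ℕ.≤ 2 ℕ.* b
  a*r≤2b with a | numerator≢0 ε | numerator≤denominator ε ε<1
  ... | _ | m , refl | a≤b = begin
    suc m ℕ.* suc (b ℕ./ suc m)                    ≡⟨ ℕ.*-comm (suc m) (suc (b ℕ./ suc m)) ⟩
    suc m ℕ.+ b ℕ./ suc m ℕ.* suc m                ≤⟨ ℕ.+-mono-≤ a≤b (ℕ.m/n*n≤m b (suc m)) ⟩
    b ℕ.+ b                                        ≡⟨ cong (b ℕ.+_) (ℕ.+-identityʳ b) ⟨
    2 ℕ.* b                                        ∎
    where open ℕ.≤-Reasoning

  private
    b*rε : fromℕ b * (fromℕ r * ε) ≡ fromℕ (a ℕ.* r)
    b*rε = begin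
      fromℕ b * (fromℕ r * ε)    ≡⟨ lemma (fromℕ b) (fromℕ r) ε ⟩
      fromℕ b * ε * fromℕ r      ≡⟨ cong (_* fromℕ r) (denominator*ε ε) ⟩
      fromℕ a * fromℕ r          ≡⟨ fromℕ-* a r ⟨
      fromℕ (a ℕ.* r)            ∎
      where
      open ≡-Reasoning
      lemma : ∀ a b c → a * (b * c) ≡ a * c * b
      lemma = solve-∀ ring

  1≤r*ε : 1ℚ ≤ fromℕ r * ε
  1≤r*ε = *-cancelˡ-≤-pos (fromℕ b) {{0<b}} (begin
    fromℕ b * 1ℚ             ≡⟨ *-identityʳ (fromℕ b) ⟩
    fromℕ b                  ≤⟨ fromℕ-mono {b} {a ℕ.* r} b≤a*r ⟩
    fromℕ (a ℕ.* r)          ≡⟨ b*rε ⟨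
    fromℕ b * (fromℕ r * ε)  ∎)
    where open ≤-Reasoning

  r*ε≤2 : fromℕ r * ε ≤ fromℕ 2
  r*ε≤2 = *-cancelˡ-≤-pos (fromℕ b) {{0<b}} (begin
    fromℕ b * (fromℕ r * ε)  ≡⟨ b*rε ⟩
    fromℕ (a ℕ.* r)          ≤⟨ fromℕ-mono {a ℕ.* r} {2 ℕ.* b} a*r≤2b ⟩
    fromℕ (2 ℕ.* b)          ≡⟨ trans (fromℕ-* 2 b) (*-comm (fromℕ 2) (fromℕ b)) ⟩
    fromℕ b * fromℕ 2        ∎)
    where open ≤-Reasoning

  private
    ν≡ : ν ≡ fromℕ 17 * fromℕ r + fromℕ 2 * fromℕ L
    ν≡ = trans (fromℕ-+ (17 ℕ.* r) (2 ℕ.* L)) (cong₂ _+_ (fromℕ-* 17 r) (fromℕ-* 2 L))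

    distrib : ∀ a r c l e → (a * r + c * l) * e ≡ a * (r * e) + c * (l * e)
    distrib = solve-∀ ring

  17≤reserve*ε : fromℕ 17 ≤ ν * ε
  17≤reserve*ε = begin
    fromℕ 17 * 1ℚ + 0ℚ                               ≤⟨ +-mono-≤ {_} {_} {0ℚ} (*-monoˡ (0≤fromℕ 17) 1≤r*ε)
                                                          (0≤* (0≤fromℕ 2) (0≤* (0≤fromℕ L) 0≤ε)) ⟩
    fromℕ 17 * (fromℕ r * ε) + fromℕ 2 * (fromℕ L * ε)  ≡⟨ distrib (fromℕ 17) (fromℕ r) (fromℕ 2) (fromℕ L) ε ⟨
    (fromℕ 17 * fromℕ r + fromℕ 2 * fromℕ L) * ε      ≡⟨ cong (_* ε) ν≡ ⟨
    ν * ε                                            ∎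
    where open ≤-Reasoning

  -- Here 39 = 17 · 2 + 2 + 3, from r ε ≤ 2, lg t ≤ t and ε ≤ 1 ≤ t. The bound serves both the
  -- linear query bound and the exposure.
  [reserve+3]*ε≤39t : 1 ℕ.≤ t → (ν + fromℕ 3) * ε ≤ fromℕ 39 * τ
  [reserve+3]*ε≤39t 1≤t = begin
    (ν + fromℕ 3) * ε
      ≡⟨ trans (cong (λ ◌ → (◌ + fromℕ 3) * ε) ν≡) (distrib′ (fromℕ 17) (fromℕ r) (fromℕ 2) (fromℕ L) (fromℕ 3) ε) ⟩
    fromℕ 17 * (fromℕ r * ε) + (fromℕ 2 * (fromℕ L * ε) + fromℕ 3 * ε)
      ≤⟨ +-mono-≤ (*-monoˡ (0≤fromℕ 17) (≤-trans r*ε≤2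
            (≤-trans (≤-reflexive (sym (*-identityʳ (fromℕ 2)))) (*-monoˡ (0≤fromℕ 2) 1≤τ))))
          (+-mono-≤ (*-monoˡ (0≤fromℕ 2) (≤-trans (*-monoˡ (0≤fromℕ L) ε≤1)
            (≤-trans (≤-reflexive (*-identityʳ (fromℕ L))) (fromℕ-mono {L} {t} (lg≤n t)))))
          (*-monoˡ (0≤fromℕ 3) (≤-trans ε≤1 1≤τ))) ⟩
    fromℕ 17 * (fromℕ 2 * τ) + (fromℕ 2 * τ + fromℕ 3 * τ)
      ≡⟨ collect τ ⟩
    fromℕ 39 * τ ∎
    where
    open ≤-Reasoning
    1≤τ : 1ℚ ≤ τ
    1≤τ = fromℕ-mono {1} {t} 1≤t
    distrib′ : ∀ a r c l k e → (a * r + c * l + k) * e ≡ a * (r * e) + (c * (l * e) + k * e)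
    distrib′ = solve-∀ ring
    collect : ∀ x → fromℕ 17 * (fromℕ 2 * x) + (fromℕ 2 * x + fromℕ 3 * x) ≡ fromℕ 39 * x
    collect = solve-∀ ring

  [1-ε]^reserve≤ : (1ℚ - ε) ^ n ≤ ℤ.+ 1 / 18
  [1-ε]^reserve≤ = ≤1/18 (0≤^ n (≤⇒0≤- ε≤1)) 17≤reserve*ε (bernoulli n 0≤ε ε≤1)

  1≤r : 1 ℕ.≤ r
  1≤r with a | numerator≢0 ε
  ... | _ | m , refl = ℕ.s≤s ℕ.z≤n

  t²*½^reserve≤ : τ * τ * ½ ^ n ≤ ½ ^ 17
  t²*½^reserve≤ = begin
    τ * τ * ½ ^ n
      ≤⟨ *-monoˡ {r = τ * τ} (0≤sq τ) (½^-antitone {17 ℕ.+ (L ℕ.+ L)} {n}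
           (ℕ.+-mono-≤ {17} {17 ℕ.* r} {L ℕ.+ L} {2 ℕ.* L} (ℕ.*-monoʳ-≤ 17 1≤r)
           (ℕ.≤-reflexive (cong (L ℕ.+_) (sym (ℕ.+-identityʳ L)))))) ⟩
    τ * τ * ½ ^ (17 ℕ.+ (L ℕ.+ L))
      ≡⟨ cong (τ * τ *_) (trans (^-homo-* ½ 17 (L ℕ.+ L)) (cong (½ ^ 17 *_) (^-homo-* ½ L L))) ⟩
    τ * τ * (½ ^ 17 * (½ ^ L * ½ ^ L))
      ≡⟨ rearrange τ (½ ^ L) (½ ^ 17) ⟩
    ½ ^ 17 * ((τ * ½ ^ L) * (τ * ½ ^ L))
      ≤⟨ *-monoˡ {r = ½ ^ 17} (0≤½^ 17) (*-mono 0≤τ½ (nonNegative⁻¹ 1ℚ) τ½≤1 τ½≤1) ⟩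
    ½ ^ 17 * (1ℚ * 1ℚ)
      ≡⟨⟩
    ½ ^ 17 ∎
    where
    open ≤-Reasoning
    rearrange : ∀ t l r → t * t * (r * (l * l)) ≡ r * ((t * l) * (t * l))
    rearrange = solve-∀ ring
    0≤τ½ : 0ℚ ≤ τ * ½ ^ L
    0≤τ½ = 0≤* (0≤fromℕ t) (0≤½^ L)
    τ½≤1 : τ * ½ ^ L ≤ 1ℚ
    τ½≤1 = begin
      τ * ½ ^ L                  ≤⟨ *-monoʳ (0≤½^ L) (fromℕ-mono {t} {2 ℕ.^ L} (n≤2^lg t)) ⟩
      fromℕ (2 ℕ.^ L) * ½ ^ L    ≡⟨ trans (cong (_* ½ ^ L) (fromℕ-^ 2 L)) (2*½^ L) ⟩
      1ℚ                         ∎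

  module _ {d : ℕ} (inRange : InRange c₀ d t ε) where

    private
      D = ½ ^ d
      ε^≤1 : ∀ k → ε ^ k ≤ 1ℚ
      ε^≤1 k = subst (ε ^ k ≤_) (1^ k) (^-monoˡ k 0≤ε ε≤1)

    range : τ ^ 4 * D ≤ c₀ ^ 4 * ε ^ 5
    range = begin
      τ ^ 4 * D                                 ≤⟨ *-monoʳ (0≤½^ d) inRange ⟩
      c₀ ^ 4 * ε ^ 5 * fromℕ 2 ^ d * D          ≡⟨ *-assoc (c₀ ^ 4 * ε ^ 5) (fromℕ 2 ^ d) D ⟩
      c₀ ^ 4 * ε ^ 5 * (fromℕ 2 ^ d * D)        ≡⟨ cong (c₀ ^ 4 * ε ^ 5 *_) (2*½^ d) ⟩
      c₀ ^ 4 * ε ^ 5 * 1ℚ                       ≡⟨ *-identityʳ (c₀ ^ 4 * ε ^ 5) ⟩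
      c₀ ^ 4 * ε ^ 5                            ∎
      where open ≤-Reasoning

    t⁴*½^d≤ : τ ^ 4 * D ≤ c₀ ^ 4
    t⁴*½^d≤ = ≤-trans range (subst (c₀ ^ 4 * ε ^ 5 ≤_) (*-identityʳ (c₀ ^ 4)) (*-monoˡ {r = c₀ ^ 4} ≤-by-dec (ε^≤1 5)))

    t²*½^d≤ : τ * τ * D ≤ c₀ ^ 4
    t²*½^d≤ = ≤-trans (*-monoʳ (0≤½^ d) (t²≤t⁴ t)) t⁴*½^d≤
      where
      lemma : ∀ a → a * a * (a * a) ≡ a * (a * (a * (a * 1ℚ)))
      lemma = solve-∀ ring
      t²≤t⁴ : ∀ t → fromℕ t * fromℕ t ≤ fromℕ t ^ 4
      t²≤t⁴ zero    = ≤-refl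
      t²≤t⁴ t@(suc _) = subst₂ _≤_ (*-identityʳ (fromℕ t * fromℕ t)) (lemma (fromℕ t))
        (*-monoˡ (0≤sq (fromℕ t)) (*-mono {1ℚ} {fromℕ t} {1ℚ} {fromℕ t} (nonNegative⁻¹ 1ℚ) (0≤fromℕ t) 1≤t 1≤t))
        where
        1≤t : 1ℚ ≤ fromℕ t
        1≤t = fromℕ-mono {1} {t} (ℕ.s≤s ℕ.z≤n)

    -- Multiplied by ε², the left-hand side is at most 39² t³ / 2^d.
    [reserve+3]²*t*½^d≤ : (ν + fromℕ 3) * (ν + fromℕ 3) * τ * D ≤ fromℕ 1521 * c₀ ^ 4
    [reserve+3]²*t*½^d≤ = helper t refl
      where
      open ≤-Reasoning
      -- Trading τ³ for τ⁴, to which the range applies, requires τ ≥ 1; hence the case distinction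
      -- on t.
      helper : ∀ s → s ≡ t → (ν + fromℕ 3) * (ν + fromℕ 3) * fromℕ t * D ≤ fromℕ 1521 * c₀ ^ 4
      helper zero refl = ≤-trans (≤-reflexive (lemma ((ν + fromℕ 3) * (ν + fromℕ 3)) D)) ≤-by-dec
        where
        lemma : ∀ a b → a * 0ℚ * b ≡ 0ℚ
        lemma = solve-∀ ring
      helper (suc s) refl = *-cancelˡ-≤-pos (ε * ε) {{pos*pos⇒pos ε ε}} (begin
        ε * ε * (X * X * τ * D)
          ≡⟨ rearrange₁ ε X τ D ⟩
        X * ε * (X * ε) * (τ * D)
          ≤⟨ *-monoʳ (0≤* (0≤fromℕ t) (0≤½^ d)) (*-mono 0≤Xε (0≤* (0≤fromℕ 39) (0≤fromℕ t)) Xε≤ Xε≤) ⟩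
        fromℕ 39 * τ * (fromℕ 39 * τ) * (τ * D)
          ≡⟨ rearrange₂ τ D ⟩
        fromℕ 1521 * (1ℚ * (τ ^ 3 * D))
          ≤⟨ *-monoˡ (0≤fromℕ 1521) (*-monoʳ (0≤* (0≤^ 3 (0≤fromℕ t)) (0≤½^ d)) (fromℕ-mono {1} {t} (ℕ.s≤s ℕ.z≤n))) ⟩
        fromℕ 1521 * (τ * (τ ^ 3 * D))
          ≡⟨ cong (fromℕ 1521 *_) (*-assoc τ (τ ^ 3) D) ⟨
        fromℕ 1521 * (τ ^ 4 * D)
          ≤⟨ *-monoˡ (0≤fromℕ 1521) range ⟩
        fromℕ 1521 * (c₀ ^ 4 * ε ^ 5)
          ≡⟨ rearrange₃ (fromℕ 1521) (c₀ ^ 4) ε ⟩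
        ε * ε * (fromℕ 1521 * c₀ ^ 4) * ε ^ 3
          ≤⟨ *-monoˡ (0≤* (0≤sq ε) (≤-by-dec {0ℚ} {fromℕ 1521 * c₀ ^ 4})) (ε^≤1 3) ⟩
        ε * ε * (fromℕ 1521 * c₀ ^ 4) * 1ℚ
          ≡⟨ *-identityʳ (ε * ε * (fromℕ 1521 * c₀ ^ 4)) ⟩
        ε * ε * (fromℕ 1521 * c₀ ^ 4) ∎)
        where
        X = ν + fromℕ 3
        0≤Xε : 0ℚ ≤ X * ε
        0≤Xε = 0≤* (0≤+ (0≤fromℕ n) (0≤fromℕ 3)) 0≤ε
        Xε≤ : X * ε ≤ fromℕ 39 * τ
        Xε≤ = [reserve+3]*ε≤39t (ℕ.s≤s ℕ.z≤n)
        rearrange₁ : ∀ e x t d → e * e * (x * x * t * d) ≡ x * e * (x * e) * (t * d)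
        rearrange₁ = solve-∀ ring
        rearrange₂ : ∀ t d → fromℕ 39 * t * (fromℕ 39 * t) * (t * d) ≡ fromℕ 1521 * (1ℚ * (t * (t * (t * 1ℚ)) * d))
        rearrange₂ = solve-∀ ring
        rearrange₃ : ∀ k c e → k * (c * (e * (e * (e * (e * (e * 1ℚ)))))) ≡ e * e * (k * c) * (e * (e * (e * 1ℚ)))
        rearrange₃ = solve-∀ ring

    -- The reserve and the last three points together fit into a square, ν² + 3 ν ≤ (ν + 3)². What
    -- remains is 3/100 + 300 · ½^17 + 1821 c₀⁴, less than 0.033.
    exposure-budget : ν * (0ℚ + ν * τ) * D +
      (fromℕ 3 * ((0ℚ + ν * τ) * D) +
       fromℕ 3 * (ℤ.+ 1 / 100 + fromℕ 100 * (τ * τ) * (½ ^ n + D))) ≤ ℤ.+ 1 / 24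
    exposure-budget = begin
      ν * (0ℚ + ν * τ) * D + (fromℕ 3 * ((0ℚ + ν * τ) * D) +
        fromℕ 3 * (ℤ.+ 1 / 100 + fromℕ 100 * (τ * τ) * (½ ^ n + D)))
        ≤⟨ 0≤-⇒≤ (subst (0ℚ ≤_) (slack ν τ D (½ ^ n) (fromℕ 3) (fromℕ 100) (ℤ.+ 1 / 100))
             (0≤* (0≤* (0≤+ (0≤* (0≤fromℕ 3) (0≤fromℕ n)) (0≤sq (fromℕ 3))) (0≤fromℕ t)) (0≤½^ d))) ⟩
      (ν + fromℕ 3) * (ν + fromℕ 3) * τ * D +
        (fromℕ 3 * (ℤ.+ 1 / 100) + fromℕ 3 * fromℕ 100 * (τ * τ * ½ ^ n + τ * τ * D))
        ≤⟨ +-mono-≤ [reserve+3]²*t*½^d≤ (+-monoʳ-≤ (fromℕ 3 * (ℤ.+ 1 / 100))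
             (*-monoˡ {r = fromℕ 3 * fromℕ 100} ≤-by-dec (+-mono-≤ t²*½^reserve≤ t²*½^d≤))) ⟩
      fromℕ 1521 * c₀ ^ 4 + (fromℕ 3 * (ℤ.+ 1 / 100) + fromℕ 3 * fromℕ 100 * (½ ^ 17 + c₀ ^ 4))
        ≤⟨ ≤-by-dec ⟩
      ℤ.+ 1 / 24 ∎
      where
      open ≤-Reasoning
      slack : ∀ ν τ D H k h c → (k * ν + k * k) * τ * D ≡
        (ν + k) * (ν + k) * τ * D + (k * c + k * h * (τ * τ * H + τ * τ * D)) -
        (ν * (0ℚ + ν * τ) * D + (k * ((0ℚ + ν * τ) * D) + k * (c + h * (τ * τ) * (H + D))))
      slack = solve-∀ ring

-- Correctness and the number of queries

agreement≡ : ∀ {d} (f : Vec Bool d → Bool) S x →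
             agreement f S x ≡ 1ℚ - indicator (¬? (f x ≟ ⊕[ S ] x))
agreement≡ f S x with ⊕[ S ] x | f x
... | false | false = refl
... | false | true  = refl
... | true  | false = refl
... | true  | true  = refl

far⇒agreement≤ : ∀ {d} f {ε} → Far {cube d} _≟_ ε (Linear d) f → ∀ S → 𝔼 (cube d) (agreement f S) ≤ 1ℚ - ε
far⇒agreement≤ {d} f {ε} far S = begin
  𝔼 (cube d) (agreement f S)
    ≡⟨ 𝔼-cong (cube d) (λ x → trans (agreement≡ f S x) (cong (1ℚ +_) (neg≡ (disagree x)))) ⟩
  (𝔼[ x ∈ cube d ] 1ℚ + - 1ℚ * disagree x)
    ≡⟨ trans (𝔼-+ (cube d) (λ _ → 1ℚ) (λ x → - 1ℚ * disagree x))
         (cong₂ _+_ (𝔼-const (cube d) 1ℚ) (𝔼-*ˡ (cube d) (- 1ℚ) disagree)) ⟩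
  1ℚ + - 1ℚ * 𝔼 (cube d) disagree
    ≡⟨ cong (1ℚ +_) (neg≡ (𝔼 (cube d) disagree)) ⟨
  1ℚ - 𝔼 (cube d) disagree
    ≡⟨ cong (λ p → 1ℚ - p) (fraction≡𝔼 (cube d) (λ x → ¬? (f x ≟ ⊕[ S ] x))) ⟨
  1ℚ - dist {cube d} _≟_ f ⊕[ S ]
    ≤⟨ +-monoʳ-≤ 1ℚ (neg-antimono-≤ (far ⊕[ S ] (S , λ _ → refl))) ⟩
  1ℚ - ε ∎
  where
  open ≤-Reasoning
  disagree : Vec Bool d → ℚ
  disagree x = indicator (¬? (f x ≟ ⊕[ S ] x))
  neg≡ : ∀ p → - p ≡ - 1ℚ * p
  neg≡ = solve-∀ ring

-- Such f has F̂(S) ≤ −½ for every S, whence 2^d ≤ 4 by Parseval.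
¾-far⇒¼≤½^d : ∀ {d} f {ε} → Far {cube d} _≟_ ε (Linear d) f → ℤ.+ 3 / 4 ≤ ε → ℤ.+ 1 / 4 ≤ ½ ^ d
¾-far⇒¼≤½^d {d} f {ε} far ¾≤ε = begin
  ℤ.+ 1 / 4
    ≡⟨ 𝔼-const (cube d) (ℤ.+ 1 / 4) ⟨
  (𝔼[ S ∈ cube d ] ℤ.+ 1 / 4)
    ≤⟨ 𝔼-mono (cube d) square≥ ⟩
  (𝔼[ S ∈ cube d ] coefficient F S * coefficient F S)
    ≡⟨ parseval f ⟩
  ½ ^ d ∎
  where
  open ≤-Reasoning
  F : Vec Bool d → ℚ
  F x = sgn (f x)
  agreement-coefficient : ∀ S → 𝔼 (cube d) (agreement f S) ≡ ½ * (1ℚ + coefficient F S)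
  agreement-coefficient S = trans (𝔼-*ˡ (cube d) ½ (λ x → 1ℚ + χ S x * F x)) (cong (½ *_)
    (trans (𝔼-+ (cube d) (λ _ → 1ℚ) (λ x → χ S x * F x))
    (cong₂ _+_ (𝔼-const (cube d) 1ℚ) (𝔼-cong (cube d) (λ x → *-comm (χ S x) (F x))))))
  -- With s = ½ (1 + c), c² - ¼ = 4 (¼ - s)(¾ - s), and both factors are nonnegative for s ≤ ¼.
  square : ∀ c → ½ * (1ℚ + c) ≤ ℤ.+ 1 / 4 → ℤ.+ 1 / 4 ≤ c * c
  square c le = 0≤-⇒≤ (subst (0ℚ ≤_) (factor c)
    (0≤* (0≤fromℕ 4) (0≤* (≤⇒0≤- le) (≤⇒0≤- (≤-trans le (≤-by-dec {ℤ.+ 1 / 4} {ℤ.+ 3 / 4}))))))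
    where
    factor : ∀ c → fromℕ 4 * ((ℤ.+ 1 / 4 - ½ * (1ℚ + c)) * (ℤ.+ 3 / 4 - ½ * (1ℚ + c))) ≡ c * c - ℤ.+ 1 / 4
    factor = solve-∀ ring
  square≥ : ∀ S → ℤ.+ 1 / 4 ≤ coefficient F S * coefficient F S
  square≥ S = square (coefficient F S) (≤-trans (≤-reflexive (sym (agreement-coefficient S)))
    (≤-trans (far⇒agreement≤ f {ε} far S) (+-monoʳ-≤ 1ℚ (neg-antimono-≤ ¾≤ε))))

coset-tester-resilient : ∀ d t ε → .{{_ : Positive ε}} → ε < 1ℚ → InRange c₀ d t ε →
  IsResilientTester _≟_ t ε (Linear d) (coset-tester d (reserve t ε))
coset-tester-resilient d t ε ε<1 inRange = record
  { accepts = λ f σ linear → subst (ℤ.+ 2 / 3 ≤_) (sym (one-sided d (reserve t ε) f σ linear)) ≤-by-dec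
  ; rejects = λ f σ far → ≤-trans {ℤ.+ 2 / 3} {1ℚ - (p + ℤ.+ 1 / 24)} ≤-by-dec
      (rejects≥ {n = reserve t ε} f σ {p} {ℤ.+ 1 / 24} (𝔼-passes≤p f far)
        (≤-trans (𝔼-exposure-queries {n = reserve t ε} f σ) (exposure-budget t ε ε<1 {d} inRange)))
  }
  where
  -- This is 7/24; with 1/24 for the exposure, the rejection probability is at least 1 - 8/24,
  -- exactly 2/3.
  p = ℤ.+ 1 / 4 * (1ℚ + (ℤ.+ 1 / 18 + (ℤ.+ 1 / 18 + ℤ.+ 1 / 18)))
  𝔼-passes≤p : ∀ f → Far {cube d} _≟_ ε (Linear d) f → _ ≤ p
  𝔼-passes≤p f far = ≤-trans (𝔼-passes f (reserve t ε) (1ℚ - ε) (far⇒agreement≤ f {ε} far))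
    (*-monoˡ {r = ℤ.+ 1 / 4} ≤-by-dec (+-monoʳ-≤ 1ℚ (+-mono-≤ κ≤ (+-mono-≤ κ≤ κ≤))))
    where κ≤ = [1-ε]^reserve≤ t ε ε<1

accept-all : ∀ d → Algorithm (cube d) Bool
accept-all d = record { Coins = bools ; tree = λ _ → output true }

-- The rejection condition is vacuous: a function this far from linear needs ½ ^ d ≥ ¼, while the
-- range with t ≥ 1 forces ½ ^ d ≤ c₀⁴.
accept-all-resilient : ∀ d t ε → .{{_ : Positive ε}} → ε < 1ℚ → 1 ℕ.≤ t → ℤ.+ 3 / 4 ≤ ε → InRange c₀ d t ε →
  IsResilientTester _≟_ t ε (Linear d) (accept-all d)
accept-all-resilient d t ε ε<1 1≤t ¾≤ε inRange = record
  { accepts = λ _ _ _ → ≤-by-dec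
  ; rejects = λ f _ far → contradiction (¼≤c₀⁴ f far) (toWitnessFalse {a? = ℤ.+ 1 / 4 ℚ.≤? c₀ ^ 4} _)
  }
  where
  ¼≤c₀⁴ : ∀ f → Far {cube d} _≟_ ε (Linear d) f → ℤ.+ 1 / 4 ≤ c₀ ^ 4
  ¼≤c₀⁴ f far = begin
    ℤ.+ 1 / 4              ≤⟨ ¾-far⇒¼≤½^d f {ε} far ¾≤ε ⟩
    ½ ^ d                  ≡⟨ *-identityˡ (½ ^ d) ⟨
    1ℚ * ½ ^ d             ≤⟨ *-monoʳ (0≤½^ d) (1≤^ 4 (fromℕ-mono {1} {t} 1≤t)) ⟩
    fromℕ t ^ 4 * ½ ^ d    ≤⟨ t⁴*½^d≤ t ε ε<1 {d} inRange ⟩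
    c₀ ^ 4                 ∎
    where open ≤-Reasoning

module _ (t : ℕ) (ε : ℚ) .{{_ : Positive ε}} (ε<1 : ε < 1ℚ) (1≤t : 1 ℕ.≤ t) where

  private
    a = ℤ.∣ ↥ ε ∣
    b = ↧ₙ ε
    r = 1+⌊ b / a ⌋
    L = lg t
    n = reserve t ε
    τ = fromℕ t
    1≤τ : 1ℚ ≤ τ
    1≤τ = fromℕ-mono {1} {t} 1≤t
    0≤ε = <⇒≤ (positive⁻¹ ε)

  t÷ε*ε : t÷ε t ε * ε ≡ τ
  t÷ε*ε = trans (*-assoc τ (1/ ε) ε) (trans (cong (τ *_) (*-inverseˡ ε)) (*-identityʳ τ))
    where instance
      ε≢0 : NonZero ε
      ε≢0 = pos⇒nonZero ε

  1≤t÷ε : 1ℚ ≤ t÷ε t ε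
  1≤t÷ε = *-cancelʳ-≤-pos ε (begin
    1ℚ * ε       ≡⟨ *-identityˡ ε ⟩
    ε            ≤⟨ <⇒≤ ε<1 ⟩
    1ℚ           ≤⟨ 1≤τ ⟩
    τ            ≡⟨ t÷ε*ε ⟨
    t÷ε t ε * ε  ∎)
    where open ≤-Reasoning

  zero-queries : ∀ C → QueryBound t ε C 0
  zero-queries C = record
    { logarithmic = subst (λ k → fromℕ 2 ^ k ≤ t÷ε t ε ^ (b ℕ.* C)) (sym (ℕ.*-zeroʳ a)) (1≤^ (b ℕ.* C) 1≤t÷ε)
    ; linear      = 0≤* (0≤fromℕ C) (≤-trans (nonNegative⁻¹ 1ℚ) 1≤t÷ε)
    }

  module _ (ε≤¾ : ε ≤ ℤ.+ 3 / 4) where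

    -- For ε ≤ ¾ the quotient t/ε is at least 4t/3, and (4/3)³ = 64/27 exceeds 2. This makes 1 + log
    -- t at most 3 log (t/ε), so additive constants in the exponent are affordable.
    2t≤[t÷ε]³ : fromℕ 2 * τ ≤ t÷ε t ε ^ 3
    2t≤[t÷ε]³ = cube-bound (t÷ε t ε) τ 1≤τ (begin
      τ                          ≡⟨ t÷ε*ε ⟨
      t÷ε t ε * ε                ≤⟨ *-monoˡ (≤-trans (nonNegative⁻¹ 1ℚ) 1≤t÷ε) ε≤¾ ⟩
      t÷ε t ε * (ℤ.+ 3 / 4)      ∎)
      where
      open ≤-Reasoning
      27/64 = ℤ.+ 27 / 64
      cube-bound : ∀ x y → 1ℚ ≤ y → y ≤ x * (ℤ.+ 3 / 4) → fromℕ 2 * y ≤ x ^ 3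
      cube-bound x y 1≤y le = *-cancelʳ-≤-pos 27/64 (begin
        fromℕ 2 * y * 27/64                         ≡⟨ rotate (fromℕ 2) y 27/64 ⟩
        fromℕ 2 * 27/64 * y                         ≤⟨ *-monoʳ 0≤y (≤-by-dec {fromℕ 2 * 27/64} {1ℚ}) ⟩
        1ℚ * y                                      ≡⟨ unit y ⟩
        y * (1ℚ * (1ℚ * 1ℚ))                        ≤⟨ *-monoˡ 0≤y (^-monoˡ 2 (nonNegative⁻¹ 1ℚ) 1≤y) ⟩
        y ^ 3                                       ≤⟨ ^-monoˡ 3 0≤y le ⟩
        (x * (ℤ.+ 3 / 4)) ^ 3                       ≡⟨ ^-distrib-* x (ℤ.+ 3 / 4) 3 ⟩
        x ^ 3 * 27/64                               ∎)
        where
        0≤y = ≤-trans (nonNegative⁻¹ 1ℚ) 1≤y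
        rotate : ∀ a b c → a * b * c ≡ a * c * b
        rotate = solve-∀ ring
        unit : ∀ a → 1ℚ * a ≡ a * (1ℚ * (1ℚ * 1ℚ))
        unit = solve-∀ ring

    -- Each of the 37 factors 2 and the two factors 2 ^ L is at most 2 t, and (2 t)^39 ≤ (t/ε)^(3 ·
    -- 39).
    2^≤[t÷ε]^ : fromℕ 2 ^ (37 ℕ.+ (L ℕ.+ L)) ≤ t÷ε t ε ^ 117
    2^≤[t÷ε]^ = begin
      fromℕ 2 ^ (37 ℕ.+ (L ℕ.+ L))
        ≡⟨ trans (^-homo-* (fromℕ 2) 37 (L ℕ.+ L)) (cong (fromℕ 2 ^ 37 *_) (^-homo-* (fromℕ 2) L L)) ⟩
      fromℕ 2 ^ 37 * (fromℕ 2 ^ L * fromℕ 2 ^ L)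
        ≤⟨ *-mono (0≤^ 37 (0≤fromℕ 2)) (0≤* 0≤2t 0≤2t) (^-monoˡ 37 (0≤fromℕ 2) 2≤2t)
             (*-mono (0≤^ L (0≤fromℕ 2)) 0≤2t 2^L≤2t 2^L≤2t) ⟩
      (fromℕ 2 * τ) ^ 37 * (fromℕ 2 * τ * (fromℕ 2 * τ))
        ≡⟨ merge (fromℕ 2 * τ) ⟩
      (fromℕ 2 * τ) ^ 39
        ≤⟨ ^-monoˡ 39 0≤2t 2t≤[t÷ε]³ ⟩
      (t÷ε t ε ^ 3) ^ 39
        ≡⟨ ^-assocʳ (t÷ε t ε) 3 39 ⟩
      t÷ε t ε ^ 117 ∎
      where
      open ≤-Reasoning
      0≤2t : 0ℚ ≤ fromℕ 2 * τ
      0≤2t = 0≤* (0≤fromℕ 2) (0≤fromℕ t)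
      2≤2t : fromℕ 2 ≤ fromℕ 2 * τ
      2≤2t = subst (_≤ fromℕ 2 * τ) (*-identityʳ (fromℕ 2)) (*-monoˡ (0≤fromℕ 2) 1≤τ)
      2^lg≤ : ∀ t → 1 ℕ.≤ t → 2 ℕ.^ lg t ℕ.≤ 2 ℕ.* t
      2^lg≤ (suc t) _ = 2^lg≤2n t
      2^L≤2t : fromℕ 2 ^ L ≤ fromℕ 2 * τ
      2^L≤2t = subst₂ _≤_ (fromℕ-^ 2 L) (fromℕ-* 2 t) (fromℕ-mono {2 ℕ.^ L} {2 ℕ.* t} (2^lg≤ t 1≤t))
      merge : ∀ y → y ^ 37 * (y * y) ≡ y ^ 39
      merge y = trans (cong (λ ◌ → y ^ 37 * (y * ◌)) (sym (*-identityʳ y))) (sym (^-homo-* y 37 2))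

    -- Here 37 = 17 · 2 + 3: the first part is the reserve for ε, the 3 is for the final queries.
    a*queries≤ : a ℕ.* (n ℕ.+ 3) ℕ.≤ (37 ℕ.+ (L ℕ.+ L)) ℕ.* b
    a*queries≤ = begin
      a ℕ.* (17 ℕ.* r ℕ.+ 2 ℕ.* L ℕ.+ 3)
        ≡⟨ expand a r L ⟩
      17 ℕ.* (a ℕ.* r) ℕ.+ (2 ℕ.* L ℕ.+ 3) ℕ.* a
        ≤⟨ ℕ.+-mono-≤ (ℕ.*-monoʳ-≤ 17 (a*r≤2b t ε ε<1))
             (ℕ.*-monoʳ-≤ (2 ℕ.* L ℕ.+ 3) (numerator≤denominator ε ε<1)) ⟩
      17 ℕ.* (2 ℕ.* b) ℕ.+ (2 ℕ.* L ℕ.+ 3) ℕ.* b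
        ≡⟨ collect b L ⟩
      (37 ℕ.+ (L ℕ.+ L)) ℕ.* b ∎
      where
      open ℕ.≤-Reasoning
      expand : ∀ a r l → a ℕ.* (17 ℕ.* r ℕ.+ 2 ℕ.* l ℕ.+ 3) ≡ 17 ℕ.* (a ℕ.* r) ℕ.+ (2 ℕ.* l ℕ.+ 3) ℕ.* a
      expand = ℕ-Solver.solve-∀
      collect : ∀ b l → 17 ℕ.* (2 ℕ.* b) ℕ.+ (2 ℕ.* l ℕ.+ 3) ℕ.* b ≡ (37 ℕ.+ (l ℕ.+ l)) ℕ.* b
      collect = ℕ-Solver.solve-∀

    reserve-queries : QueryBound t ε 117 (n ℕ.+ 3)
    reserve-queries = record
      { logarithmic = begin
          fromℕ 2 ^ (a ℕ.* (n ℕ.+ 3))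
            ≤⟨ 2^-mono a*queries≤ ⟩
          fromℕ 2 ^ ((37 ℕ.+ (L ℕ.+ L)) ℕ.* b)
            ≡⟨ ^-assocʳ (fromℕ 2) (37 ℕ.+ (L ℕ.+ L)) b ⟨
          (fromℕ 2 ^ (37 ℕ.+ (L ℕ.+ L))) ^ b
            ≤⟨ ^-monoˡ b (0≤^ (37 ℕ.+ (L ℕ.+ L)) (0≤fromℕ 2)) 2^≤[t÷ε]^ ⟩
          (t÷ε t ε ^ 117) ^ b
            ≡⟨ trans (^-assocʳ (t÷ε t ε) 117 b) (cong (t÷ε t ε ^_) (ℕ.*-comm 117 b)) ⟩
          t÷ε t ε ^ (b ℕ.* 117) ∎
      ; linear = *-cancelʳ-≤-pos ε (begin
          fromℕ (n ℕ.+ 3) * ε             ≡⟨ cong (_* ε) (fromℕ-+ n 3) ⟩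
          (fromℕ n + fromℕ 3) * ε         ≤⟨ [reserve+3]*ε≤39t t ε ε<1 1≤t ⟩
          fromℕ 39 * τ                    ≤⟨ *-monoʳ (0≤fromℕ t) (≤-by-dec {fromℕ 39} {fromℕ 117}) ⟩
          fromℕ 117 * τ                   ≡⟨ cong (fromℕ 117 *_) t÷ε*ε ⟨
          fromℕ 117 * (t÷ε t ε * ε)       ≡⟨ *-assoc (fromℕ 117) (t÷ε t ε) ε ⟨
          fromℕ 117 * t÷ε t ε * ε         ∎)
      }
      where
      open ≤-Reasoning
      2^-mono : ∀ {j k} → j ℕ.≤ k → fromℕ 2 ^ j ≤ fromℕ 2 ^ k
      2^-mono {k = k} ℕ.z≤n      = 1≤^ k ≤-by-dec
      2^-mono         (ℕ.s≤s le) = *-monoˡ (0≤fromℕ 2) (2^-mono le)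

-- For t ≥ 1 and ε close to 1, log (t/ε) is too small to allow any query.
choose-tester : ∀ d t ε → Dec (t ≡ 0 ⊎ ε ≤ ℤ.+ 3 / 4) → Algorithm (cube d) Bool
choose-tester d t ε (yes _) = coset-tester d (reserve t ε)
choose-tester d t ε (no  _) = accept-all d

theorem1p1 : ∃[ c₀ ] 0ℚ < c₀ × c₀ < 1ℚ ×
    (Σ[ tester ∈ ((d t : ℕ) (ε : ℚ) → Algorithm (cube d) Bool) ] Σ[ C ∈ ℕ ]
    (∀ d t ε → .{{_ : Positive ε}} → ε < 1ℚ →
    NonAdaptive (tester d t ε) ×
    OneSidedError t (Linear d) (tester d t ε) ×
    (InRange c₀ d t ε → IsResilientTester _≟_ t ε (Linear d) (tester d t ε)) ×
    (1 ℕ.≤ t → ∃[ q ] MakesAtMost q queries (tester d t ε) × QueryBound t ε C q)))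
theorem1p1 = c₀ , toWitness {a? = 0ℚ <? c₀} _ , toWitness {a? = c₀ <? 1ℚ} _ ,
  -- For t = 0 the range contains every d, so a genuine test is required even for ε near 1; the
  -- query bound is asked only for t ≥ 1.
  (λ d t ε → choose-tester d t ε (t ℕ.≟ 0 ⊎-dec ε ℚ.≤? ℤ.+ 3 / 4)) , 117 ,
  λ d t ε ε<1 → correct d t ε ε<1 (t ℕ.≟ 0 ⊎-dec ε ℚ.≤? ℤ.+ 3 / 4)
  where
  correct : ∀ d t ε → .{{_ : Positive ε}} → ε < 1ℚ → (t-or-ε-small : Dec (t ≡ 0 ⊎ ε ≤ ℤ.+ 3 / 4)) →
    let tester = choose-tester d t ε t-or-ε-small in
    NonAdaptive tester × OneSidedError t (Linear d) tester ×
    (InRange c₀ d t ε → IsResilientTester _≟_ t ε (Linear d) tester) ×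
    (1 ℕ.≤ t → ∃[ q ] MakesAtMost q queries tester × QueryBound t ε 117 q)
  correct d t ε ε<1 (yes small) =
    (λ (z , I , J , x) → _ , ask-asks (queries z I J x) (decision I J)) ,
    one-sided d (reserve t ε) ,
    coset-tester-resilient d t ε ε<1 ,
    λ 1≤t → reserve t ε ℕ.+ 3 ,
      (λ (z , I , J , x) → ask-asksAtMost (queries z I J x) (decision I J)) ,
      reserve-queries t ε ε<1 1≤t (ε≤¾ 1≤t small)
    where
    ε≤¾ : 1 ℕ.≤ t → t ≡ 0 ⊎ ε ≤ ℤ.+ 3 / 4 → ε ≤ ℤ.+ 3 / 4
    ε≤¾ 1≤t (inj₁ refl) = contradiction 1≤t λ ()
    ε≤¾ _   (inj₂ le)   = le
  correct d t ε ε<1 (no ¬small) =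
    (λ _ → [] , output) ,
    (λ _ _ _ → refl) ,
    accept-all-resilient d t ε ε<1 (ℕ.n≢0⇒n>0 (¬small ∘ inj₁)) (<⇒≤ (≰⇒> (¬small ∘ inj₂))) ,
    λ 1≤t → 0 , (λ _ → output) , zero-queries t ε ε<1 1≤t 117
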